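{- There exists an absolute constant $C>0$ such that for all integers $b\ge 1$ and $s\ge 2$ there exists an ordered graph with at most $s\,e^{C\log b\,\sqrt{\log s}}$ edges for which every $b$-coloring of the vertices contains a monochromatic ordered path of length $s$.
   Context: An ordered graph on $n$ vertices is a finite simple graph whose vertices are labeled $1,2,\ldots,n$ (equivalently, a finite simple graph with a linear order on its vertices). An ordered path of length $s$ in an ordered graph is a monotone increasing path with $s$ edges, i.e. vertices $v_0<v_1<\cdots<v_s$ such that $v_{i-1}v_i$ is an edge for every $1\le i\le s$. A $b$-coloring of the vertices is an arbitrary (not necessarily proper) assignment of one of $b$ colors to each vertex; an ordered path is monochromatic if all of its vertices have the same color. $\log$ is the natural logarithm. -}

module Defs where

open import Algebra.Bundles using (CommutativeRing)
open import Data.Empty using (⊥; ⊥-elim)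
open import Data.Fin.Base as Fin using (Fin; inject₁)
import Data.Fin.Properties as Fin
import Data.Integer.Base as ℤ
import Data.Integer.Properties as ℤ
open import Data.List.Base using (List; allFin; cartesianProduct; filter; length)
open import Data.Nat.Base as ℕ using (ℕ; zero; suc)
import Data.Nat.Properties as ℕ
import Data.Nat.Coprimality as Coprime
open import Data.Product.Base
  using (Σ-syntax; ∃; ∃-syntax; _×_; _,_; proj₁; proj₂)
open import Data.Rational.Base
open import Data.Rational.Properties
open import Data.Rational.Solver using (module +-*-Solver)
import Data.Rational.Unnormalised.Base as ℚᵘ
import Data.Rational.Unnormalised.Properties as ℚᵘ
open import Data.Sum.Base as Sum using (_⊎_; inj₁; inj₂)
open import Level using (0ℓ)
open import Relation.Binary.Core using (Rel)
open import Relation.Binary.Definitions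
  using (Decidable; Symmetric; Irreflexive; tri<; tri≈; tri>)
open import Relation.Binary.PropositionalEquality
  using (_≡_; refl; sym; trans; cong; subst; subst₂)
open import Relation.Nullary.Decidable using (yes; no; _×-dec_)
open import Relation.Nullary.Negation using (¬_)

open import Algebra.Properties.CommutativeSemiring.Exp
  (CommutativeRing.commutativeSemiring +-*-commutativeRing) public
  using (_^_; ^-assocʳ; ^-distrib-*)

open +-*-Solver using (solve; con; _:=_; _:+_; _:*_; _:-_; :-_)

<-by : ∀ {p q} d → 0ℚ < d → p + d ≡ q → p < q
<-by {p} d 0<d eq =
  subst₂ _<_ (+-identityʳ p) eq (+-monoʳ-< p 0<d)

≤-by : ∀ {p q} d → 0ℚ ≤ d → p + d ≡ q → p ≤ q
≤-by {p} d 0≤d eq =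
  subst₂ _≤_ (+-identityʳ p) eq (+-monoʳ-≤ p 0≤d)

p+[q-p] : ∀ p q → p + (q - p) ≡ q
p+[q-p] = solve 2 (λ p q → p :+ (q :- p) := q) refl

0<q-p : ∀ {p q} → p < q → 0ℚ < q - p
0<q-p {p} {q} p<q = subst (_< q - p) (+-inverseʳ p) (+-monoˡ-< (- p) p<q)

0≤q-p : ∀ {p q} → p ≤ q → 0ℚ ≤ q - p
0≤q-p {p} {q} p≤q = subst (_≤ q - p) (+-inverseʳ p) (+-monoˡ-≤ (- p) p≤q)

0<+ : ∀ {p q} → 0ℚ < p → 0ℚ ≤ q → 0ℚ < p + q
0<+ 0<p 0≤q = +-mono-<-≤ 0<p 0≤q

0≤+ : ∀ {p q} → 0ℚ ≤ p → 0ℚ ≤ q → 0ℚ ≤ p + q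
0≤+ 0≤p 0≤q = +-mono-≤ 0≤p 0≤q

*-monoʳ-≤ : ∀ {r p q} → 0ℚ ≤ r → p ≤ q → r * p ≤ r * q
*-monoʳ-≤ {r} 0≤r = *-monoˡ-≤-nonNeg r {{nonNegative 0≤r}}

*-monoˡ-≤ : ∀ {r p q} → 0ℚ ≤ r → p ≤ q → p * r ≤ q * r
*-monoˡ-≤ {r} 0≤r = *-monoʳ-≤-nonNeg r {{nonNegative 0≤r}}

*-monoʳ-< : ∀ {r p q} → 0ℚ < r → p < q → r * p < r * q
*-monoʳ-< {r} 0<r = *-monoʳ-<-pos r {{positive 0<r}}

*-monoˡ-< : ∀ {r p q} → 0ℚ < r → p < q → p * r < q * r
*-monoˡ-< {r} 0<r = *-monoˡ-<-pos r {{positive 0<r}}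

*-mono-≤ : ∀ {p q r s} → 0ℚ ≤ p → p ≤ q → 0ℚ ≤ r → r ≤ s → p * r ≤ q * s
*-mono-≤ 0≤p p≤q 0≤r r≤s =
  ≤-trans (*-monoˡ-≤ 0≤r p≤q) (*-monoʳ-≤ (≤-trans 0≤p p≤q) r≤s)

0≤* : ∀ {p q} → 0ℚ ≤ p → 0ℚ ≤ q → 0ℚ ≤ p * q
0≤* {p} {q} 0≤p 0≤q = subst (_≤ p * q) (*-zeroʳ p) (*-monoʳ-≤ 0≤p 0≤q)

0<* : ∀ {p q} → 0ℚ < p → 0ℚ < q → 0ℚ < p * q
0<* {p} {q} 0<p 0<q = subst (_< p * q) (*-zeroʳ p) (*-monoʳ-< 0<p 0<q)

0≤p*p : ∀ p → 0ℚ ≤ p * p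
0≤p*p p with ≤-total 0ℚ p
... | inj₁ 0≤p = 0≤* 0≤p 0≤p
... | inj₂ p≤0 = subst (0ℚ ≤_)
  (solve 1 (λ p → (:- p) :* (:- p) := p :* p) refl p)
  (0≤* (neg-antimono-≤ p≤0) (neg-antimono-≤ p≤0))

square-< : ∀ {p q} → 0ℚ ≤ p → p < q → p * p < q * q
square-< 0≤p p<q =
  ≤-<-trans (*-monoʳ-≤ 0≤p (<⇒≤ p<q)) (*-monoˡ-< (≤-<-trans 0≤p p<q) p<q)

0<1 : 0ℚ < 1ℚ
0<1 = positive⁻¹ 1ℚ

0<½ : 0ℚ < ½
0<½ = positive⁻¹ ½

inverse : ∀ {q} → 0ℚ < q → ∃[ r ] 0ℚ < r × q * r ≡ 1ℚ
inverse {q} 0<q = 1/ q , positive⁻¹ (1/ q) {{1/pos⇒pos q}} , *-inverseʳ q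
  where
  instance
    _ = positive 0<q
    _ = pos⇒nonZero q

p≤∣p∣ : ∀ p → p ≤ ∣ p ∣
p≤∣p∣ p with ≤-total 0ℚ p
... | inj₁ 0≤p = ≤-reflexive (sym (0≤p⇒∣p∣≡p 0≤p))
... | inj₂ p≤0 = ≤-trans p≤0 (0≤∣p∣ p)

-p≤∣p∣ : ∀ p → - p ≤ ∣ p ∣
-p≤∣p∣ p = subst (- p ≤_) (∣-p∣≡∣p∣ p) (p≤∣p∣ (- p))

ℕ→ℚ : ℕ → ℚ
ℕ→ℚ n = ℤ.+ n / 1

1/1+ : ℕ → ℚ
1/1+ n = ℤ.+ 1 / suc n

ℕ→ℚ≡mkℚ : ∀ n → ℕ→ℚ n ≡ mkℚ (ℤ.+ n) 0 (Coprime.sym (Coprime.1-coprimeTo n))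
ℕ→ℚ≡mkℚ n = normalize-coprime (Coprime.sym (Coprime.1-coprimeTo n))

1/1+≡mkℚ : ∀ n → 1/1+ n ≡ mkℚ (ℤ.+ 1) n (Coprime.1-coprimeTo (suc n))
1/1+≡mkℚ n = normalize-coprime (Coprime.1-coprimeTo (suc n))

ℕ→ℚ-mono-< : ∀ {m n} → m ℕ.< n → ℕ→ℚ m < ℕ→ℚ n
ℕ→ℚ-mono-< {m} {n} m<n rewrite ℕ→ℚ≡mkℚ m | ℕ→ℚ≡mkℚ n =
  *<* (ℤ.*-monoʳ-<-pos (ℤ.+ 1) (ℤ.+<+ m<n))

ℕ→ℚ-suc : ∀ n → ℕ→ℚ (suc n) ≡ 1ℚ + ℕ→ℚ n
ℕ→ℚ-suc n = toℚᵘ-injective (ℚᵘ.≃-trans lem (ℚᵘ.≃-sym (toℚᵘ-homo-+ 1ℚ (ℕ→ℚ n))))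
  where
  lem : toℚᵘ (ℕ→ℚ (suc n)) ℚᵘ.≃ toℚᵘ 1ℚ ℚᵘ.+ toℚᵘ (ℕ→ℚ n)
  lem rewrite ℕ→ℚ≡mkℚ (suc n) | ℕ→ℚ≡mkℚ n | ℕ.*-identityʳ n
            | ℤ.+◃n≡+n n = ℚᵘ.*≡* refl

0≤ℕ→ℚ : ∀ n → 0ℚ ≤ ℕ→ℚ n
0≤ℕ→ℚ zero    = ≤-refl
0≤ℕ→ℚ (suc n) = <⇒≤ (ℕ→ℚ-mono-< {0} {suc n} (ℕ.s≤s ℕ.z≤n))

suc*1/1+ : ∀ n → ℕ→ℚ (suc n) * 1/1+ n ≡ 1ℚ
suc*1/1+ n rewrite ℕ→ℚ≡mkℚ (suc n) | 1/1+≡mkℚ n =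
  *-inverseʳ (mkℚ (ℤ.+ suc n) 0 (Coprime.sym (Coprime.1-coprimeTo (suc n))))

0<1/1+ : ∀ n → 0ℚ < 1/1+ n
0<1/1+ n = positive⁻¹ (1/1+ n) {{normalize-pos 1 (suc n)}}

1/1+≤1 : ∀ n → 1/1+ n ≤ 1ℚ
1/1+≤1 n = subst₂ _≤_ (*-identityˡ _) (suc*1/1+ n)
  (*-monoˡ-≤ (<⇒≤ (0<1/1+ n)) 1≤suc)
  where
  1≤suc : 1ℚ ≤ ℕ→ℚ (suc n)
  1≤suc = ≤-by (ℕ→ℚ n) (0≤ℕ→ℚ n) (sym (ℕ→ℚ-suc n))

below-ℕ : ∀ p → ∃[ n ] p < ℕ→ℚ (suc n)
below-ℕ p@(mkℚ i d _) = ℤ.∣ i ∣ , lem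
  where
  lem : p < ℕ→ℚ (suc ℤ.∣ i ∣)
  lem rewrite ℕ→ℚ≡mkℚ (suc ℤ.∣ i ∣) = *<* (ℤ.≤-<-trans
    (ℤ.≤-trans (ℤ.≤-reflexive (ℤ.*-identityʳ i)) (i≤+∣i∣ i))
    (ℤ.+<+ (ℕ.<-≤-trans (ℕ.n<1+n ℤ.∣ i ∣) (ℕ.m≤m*n (suc ℤ.∣ i ∣) (suc d)))))
    where
    i≤+∣i∣ : ∀ j → j ℤ.≤ ℤ.+ ℤ.∣ j ∣
    i≤+∣i∣ (ℤ.+ _)     = ℤ.≤-refl
    i≤+∣i∣ ℤ.-[1+ _ ] = ℤ.-≤+

private
  archimedean′ : ∀ p {ε} → 0ℚ < ε → ∃[ n ] p * 1/1+ n < ε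
  archimedean′ p {ε} 0<ε with inverse 0<ε
  ... | r , _ , εr≡1 with below-ℕ (r * p)
  ... | n , rp<n = n , subst₂ _<_
    (trans (sym (*-assoc ε (r * p) (1/1+ n)))
      (cong (_* 1/1+ n) (trans (sym (*-assoc ε r p)) (trans (cong (_* p) εr≡1) (*-identityˡ p)))))
    (trans (cong (ε *_) (suc*1/1+ n)) (*-identityʳ ε))
    (*-monoʳ-< 0<ε (*-monoˡ-< (0<1/1+ n) rp<n))

abstract
  archimedean : ∀ p {ε} → 0ℚ < ε → ∃[ n ] p * 1/1+ n < ε
  archimedean = archimedean′

0≤^ : ∀ {p} → 0ℚ ≤ p → ∀ n → 0ℚ ≤ p ^ n
0≤^ 0≤p zero    = <⇒≤ 0<1
0≤^ 0≤p (suc n) = 0≤* 0≤p (0≤^ 0≤p n)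

0<^ : ∀ {p} → 0ℚ < p → ∀ n → 0ℚ < p ^ n
0<^ 0<p zero    = 0<1
0<^ 0<p (suc n) = 0<* 0<p (0<^ 0<p n)

^-monoˡ-≤ : ∀ {p q} → 0ℚ ≤ p → p ≤ q → ∀ n → p ^ n ≤ q ^ n
^-monoˡ-≤ 0≤p p≤q zero    = ≤-refl
^-monoˡ-≤ 0≤p p≤q (suc n) = *-mono-≤ 0≤p p≤q (0≤^ 0≤p n) (^-monoˡ-≤ 0≤p p≤q n)

1^ : ∀ n → 1ℚ ^ n ≡ 1ℚ
1^ zero    = refl
1^ (suc n) = trans (*-identityˡ (1ℚ ^ n)) (1^ n)

bernoulli : ∀ {p} → 0ℚ ≤ 1ℚ + p → ∀ n → 1ℚ + ℕ→ℚ n * p ≤ (1ℚ + p) ^ n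
bernoulli {p} 0≤1+p zero =
  ≤-reflexive (trans (cong (1ℚ +_) (*-zeroˡ p)) (+-identityʳ 1ℚ))
bernoulli {p} 0≤1+p (suc n) = ≤-trans
  (≤-by (ℕ→ℚ n * (p * p)) (0≤* (0≤ℕ→ℚ n) (0≤p*p p)) eq)
  (*-monoʳ-≤ 0≤1+p (bernoulli 0≤1+p n))
  where
  eq : 1ℚ + ℕ→ℚ (suc n) * p + ℕ→ℚ n * (p * p) ≡ (1ℚ + p) * (1ℚ + ℕ→ℚ n * p)
  eq rewrite ℕ→ℚ-suc n = solve 2
    (λ N p → con 1ℚ :+ (con 1ℚ :+ N) :* p :+ N :* (p :* p)
          := (con 1ℚ :+ p) :* (con 1ℚ :+ N :* p)) refl (ℕ→ℚ n) p

lo hi : ℕ → ℚ → ℚ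
lo n r = (1ℚ + r * 1/1+ n) ^ suc n
hi n r = (1ℚ - r * 1/1+ n) ^ suc n

private
  refine : ∀ t m → 0ℚ ≤ 1ℚ + ℕ→ℚ (suc m) * t →
           (0ℚ ≤ 1ℚ + t) × (1ℚ + ℕ→ℚ (suc m) * t ≤ (1ℚ + t) ^ suc m)
  refine t m h = 0≤1+t , bernoulli 0≤1+t (suc m)
    where
    0≤1+t : 0ℚ ≤ 1ℚ + t
    0≤1+t with ≤-total 0ℚ t
    ... | inj₁ 0≤t = 0≤+ (<⇒≤ 0<1) 0≤t
    ... | inj₂ t≤0 = ≤-trans h (≤-by (ℕ→ℚ m * (- t))
      (0≤* (0≤ℕ→ℚ m) (neg-antimono-≤ t≤0)) eq)
      where
      eq : 1ℚ + ℕ→ℚ (suc m) * t + ℕ→ℚ m * (- t) ≡ 1ℚ + t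
      eq rewrite ℕ→ℚ-suc m = solve 2
        (λ N t → con 1ℚ :+ (con 1ℚ :+ N) :* t :+ N :* (:- t) := con 1ℚ :+ t)
        refl (ℕ→ℚ m) t

private
  lo*hi≤1′ : ∀ {r s} n m → r ≤ s → 0ℚ ≤ 1ℚ + r * 1/1+ n → 0ℚ ≤ 1ℚ - s * 1/1+ m →
            lo n r * hi m s ≤ 1ℚ
  lo*hi≤1′ {r} {s} n m r≤s 0≤a 0≤b′ = begin
    lo n r * hi m s
      ≤⟨ *-monoʳ-≤ (0≤^ 0≤a (suc n)) (^-monoˡ-≤ 0≤b′ b′≤b (suc m)) ⟩
    lo n r * hi m r
      ≤⟨ *-mono-≤ (0≤^ 0≤a (suc n)) lo≤ (0≤^ 0≤b (suc m)) hi≤ ⟩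
    (1ℚ + t) ^ K * (1ℚ + (- t)) ^ K
      ≡⟨ sym (^-distrib-* (1ℚ + t) (1ℚ + (- t)) K) ⟩
    ((1ℚ + t) * (1ℚ + (- t))) ^ K
      ≤⟨ ^-monoˡ-≤ (0≤* 0≤1+t 0≤1-t) prod≤1 K ⟩
    1ℚ ^ K
      ≡⟨ 1^ K ⟩
    1ℚ ∎
    where
    open ≤-Reasoning
    K = suc m ℕ.* suc n
    N = ℕ→ℚ (suc n)
    M = ℕ→ℚ (suc m)
    t = r * 1/1+ n * 1/1+ m
    b′≤b : 1ℚ - s * 1/1+ m ≤ 1ℚ - r * 1/1+ m
    b′≤b = +-monoʳ-≤ 1ℚ (neg-antimono-≤ (*-monoˡ-≤ (<⇒≤ (0<1/1+ m)) r≤s))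
    0≤b : 0ℚ ≤ 1ℚ - r * 1/1+ m
    0≤b = ≤-trans 0≤b′ b′≤b
    Mt : 1ℚ + r * 1/1+ n ≡ 1ℚ + M * t
    Mt = cong (1ℚ +_) (trans (sym (*-identityʳ (r * 1/1+ n))) (trans
      (cong (r * 1/1+ n *_) (sym (suc*1/1+ m)))
      (solve 3 (λ a M i → a :* (M :* i) := M :* (a :* i)) refl (r * 1/1+ n) M (1/1+ m))))
    Nt : 1ℚ - r * 1/1+ m ≡ 1ℚ + N * (- t)
    Nt = cong (1ℚ +_) (trans (cong -_ (trans (sym (*-identityʳ (r * 1/1+ m)))
      (cong (r * 1/1+ m *_) (sym (suc*1/1+ n)))))
      (solve 4 (λ r i N j → :- (r :* i :* (N :* j)) := N :* (:- (r :* j :* i))) refl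
        r (1/1+ m) N (1/1+ n)))
    A = refine t m (subst (0ℚ ≤_) Mt 0≤a)
    B = refine (- t) n (subst (0ℚ ≤_) Nt 0≤b)
    0≤1+t = proj₁ A
    0≤1-t = proj₁ B
    lo≤ : lo n r ≤ (1ℚ + t) ^ K
    lo≤ = subst (lo n r ≤_) (^-assocʳ (1ℚ + t) (suc m) (suc n))
      (^-monoˡ-≤ 0≤a (subst (_≤ (1ℚ + t) ^ suc m) (sym Mt) (proj₂ A)) (suc n))
    hi≤ : hi m r ≤ (1ℚ + (- t)) ^ K
    hi≤ = subst (hi m r ≤_)
      (trans (^-assocʳ (1ℚ + (- t)) (suc n) (suc m))
             (cong ((1ℚ + (- t)) ^_) (ℕ.*-comm (suc n) (suc m))))
      (^-monoˡ-≤ 0≤b (subst (_≤ (1ℚ + (- t)) ^ suc n) (sym Nt) (proj₂ B)) (suc m))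
    prod≤1 : (1ℚ + t) * (1ℚ + (- t)) ≤ 1ℚ
    prod≤1 = ≤-by (t * t) (0≤p*p t) (solve 1
      (λ t → (con 1ℚ :+ t) :* (con 1ℚ :+ (:- t)) :+ t :* t := con 1ℚ) refl t)

abstract
  lo*hi≤1 : ∀ {r s} n m → r ≤ s → 0ℚ ≤ 1ℚ + r * 1/1+ n → 0ℚ ≤ 1ℚ - s * 1/1+ m →
            lo n r * hi m s ≤ 1ℚ
  lo*hi≤1 = lo*hi≤1′

private
  lo*hi-large′ : ∀ a b {δ} → 0ℚ < δ → ∃[ n ]
    (0ℚ < 1ℚ + a * 1/1+ n) × (0ℚ < 1ℚ - b * 1/1+ n) ×
    (1ℚ + (a - b) - δ < lo n a * hi n b)
  lo*hi-large′ a b {δ} 0<δ = n , 0<1+ai , 0<1-bi , large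
    where
    A = ∣ a ∣
    B = ∣ b ∣
    D = ∣ a * b ∣
    S = A + B + D
    ε : Σ[ ε ∈ ℚ ] (0ℚ < ε × ε ≤ δ × ε ≤ 1ℚ)
    ε with ≤-total δ 1ℚ
    ... | inj₁ δ≤1 = δ , 0<δ , ≤-refl , δ≤1
    ... | inj₂ 1≤δ = 1ℚ , 0<1 , 1≤δ , ≤-refl
    arch = archimedean S (proj₁ (proj₂ ε))
    n = proj₁ arch
    i = 1/1+ n
    N = ℕ→ℚ (suc n)
    small : ∀ {p} → p ≤ S → p * i < proj₁ ε
    small p≤S = ≤-<-trans (*-monoˡ-≤ (<⇒≤ (0<1/1+ n)) p≤S) (proj₂ arch)
    A≤S : A ≤ S
    A≤S = ≤-by (B + D) (0≤+ (0≤∣p∣ b) (0≤∣p∣ (a * b))) (sym (+-assoc A B D))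
    B≤S : B ≤ S
    B≤S = ≤-by (A + D) (0≤+ (0≤∣p∣ a) (0≤∣p∣ (a * b)))
      (solve 3 (λ A B D → B :+ (A :+ D) := A :+ B :+ D) refl A B D)
    D≤S : D ≤ S
    D≤S = ≤-by (A + B) (0≤+ (0≤∣p∣ a) (0≤∣p∣ b)) (+-comm D (A + B))
    0<1+ai : 0ℚ < 1ℚ + a * i
    0<1+ai = subst (0ℚ <_) (solve 2 (λ a i → con 1ℚ :- (:- a) :* i := con 1ℚ :+ a :* i) refl a i)
      (0<q-p (<-≤-trans (small (≤-trans (-p≤∣p∣ a) A≤S)) (proj₂ (proj₂ (proj₂ ε)))))
    0<1-bi : 0ℚ < 1ℚ - b * i
    0<1-bi = 0<q-p (<-≤-trans (small (≤-trans (p≤∣p∣ b) B≤S)) (proj₂ (proj₂ (proj₂ ε))))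
    abi<δ : a * b * i < δ
    abi<δ = <-≤-trans (small (≤-trans (p≤∣p∣ (a * b)) D≤S)) (proj₁ (proj₂ (proj₂ ε)))
    y = (a - b) * i - a * b * i * i
    base : (1ℚ + a * i) * (1ℚ - b * i) ≡ 1ℚ + y
    base = solve 3 (λ a b i → (con 1ℚ :+ a :* i) :* (con 1ℚ :- b :* i)
      := con 1ℚ :+ ((a :- b) :* i :- a :* b :* i :* i)) refl a b i
    Ny : 1ℚ + (a - b) - a * b * i ≡ 1ℚ + N * y
    Ny = trans (solve 3 (λ a b i → con 1ℚ :+ (a :- b) :- a :* b :* i
                  := con 1ℚ :+ con 1ℚ :* ((a :- b) :- a :* b :* i)) refl a b i)
        (trans (cong (λ u → 1ℚ + u * ((a - b) - a * b * i)) (sym (suc*1/1+ n)))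
          (solve 4 (λ a b i N → con 1ℚ :+ N :* i :* ((a :- b) :- a :* b :* i)
             := con 1ℚ :+ N :* ((a :- b) :* i :- a :* b :* i :* i)) refl a b i N))
    open ≤-Reasoning
    large : 1ℚ + (a - b) - δ < lo n a * hi n b
    large = begin-strict
      1ℚ + (a - b) - δ          <⟨ +-monoʳ-< (1ℚ + (a - b)) (neg-antimono-< abi<δ) ⟩
      1ℚ + (a - b) - a * b * i  ≡⟨ Ny ⟩
      1ℚ + N * y                ≤⟨ bernoulli (subst (0ℚ ≤_) base
                                     (0≤* (<⇒≤ 0<1+ai) (<⇒≤ 0<1-bi))) (suc n) ⟩
      (1ℚ + y) ^ suc n          ≡⟨ cong (_^ suc n) (sym base) ⟩
      ((1ℚ + a * i) * (1ℚ - b * i)) ^ suc n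
                                ≡⟨ ^-distrib-* (1ℚ + a * i) (1ℚ - b * i) (suc n) ⟩
      lo n a * hi n b           ∎

abstract
  lo*hi-large : ∀ a b {δ} → 0ℚ < δ → ∃[ n ]
    (0ℚ < 1ℚ + a * 1/1+ n) × (0ℚ < 1ℚ - b * 1/1+ n) ×
    (1ℚ + (a - b) - δ < lo n a * hi n b)
  lo*hi-large = lo*hi-large′

-- Two-sided Dedekind cuts of ℚ.
record ℝ : Set₁ where
  field
    lower upper     : ℚ → Set
    lower-inhabited : ∃ lower
    upper-inhabited : ∃ upper
    lower-closed    : ∀ {p q} → p < q → lower q → lower p
    upper-closed    : ∀ {p q} → p < q → upper p → upper q
    lower-open      : ∀ {p} → lower p → ∃[ q ] p < q × lower q
    upper-open      : ∀ {q} → upper q → ∃[ p ] p < q × upper p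
    disjoint        : ∀ {q} → lower q → ¬ upper q
    located         : ∀ {p q} → p < q → lower p ⊎ upper q

  lower<upper : ∀ {p q} → lower p → upper q → p < q
  lower<upper {p} {q} Lp Uq with <-cmp p q
  ... | tri< p<q _ _ = p<q
  ... | tri≈ _ refl _ = ⊥-elim (disjoint Lp Uq)
  ... | tri> _ _ q<p = ⊥-elim (disjoint (lower-closed q<p Lp) Uq)

open ℝ

abstract
  approximation : ∀ x {ε} → 0ℚ < ε → ∃[ q ] lower x q × upper x (q + ε)
  approximation x {ε} 0<ε = start (lower-inhabited x) (upper-inhabited x)
    where
    h : ℚ
    h = ε * ½
    0<h : 0ℚ < h
    0<h = 0<* 0<ε 0<½
    h+h : ∀ a → a + h + h ≡ a + ε
    h+h a = solve 2 (λ a e → a :+ e :* con ½ :+ e :* con ½ := a :+ e) refl a ε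
    a<a+h : ∀ a → a < a + h
    a<a+h a = <-by h 0<h refl
    search : ∀ k a → lower x a → upper x (a + ℕ→ℚ k * h) → ∃[ q ] lower x q × upper x (q + ε)
    search zero a La Ua = ⊥-elim (disjoint x La
      (subst (upper x) (solve 2 (λ a h → a :+ con 0ℚ :* h := a) refl a h) Ua))
    search (suc k) a La Ua with located x (a<a+h (a + h))
    ... | inj₁ La+h = search k (a + h) La+h (subst (upper x) eq Ua)
      where
      eq : a + ℕ→ℚ (suc k) * h ≡ a + h + ℕ→ℚ k * h
      eq rewrite ℕ→ℚ-suc k = solve 3
        (λ a k h → a :+ (con 1ℚ :+ k) :* h := a :+ h :+ k :* h) refl a (ℕ→ℚ k) h
    ... | inj₂ Ua+2h = a , La , subst (upper x) (h+h a) Ua+2h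
    start : ∃ (lower x) → ∃ (upper x) → ∃[ q ] lower x q × upper x (q + ε)
    start (a , La) (b , Ub) with inverse 0<h
    ... | r , _ , hr≡1 with below-ℕ ((b - a) * r)
    ...   | n , lt = search (suc n) a La (upper-closed x b<a+nh Ub)
      where
      b-a : (b - a) * r * h ≡ b - a
      b-a = trans (*-assoc (b - a) r h)
        (trans (cong ((b - a) *_) (trans (*-comm r h) hr≡1)) (*-identityʳ (b - a)))
      b<a+nh : b < a + ℕ→ℚ (suc n) * h
      b<a+nh = subst (_< a + ℕ→ℚ (suc n) * h) (p+[q-p] a b)
        (+-monoʳ-< a (subst (_< ℕ→ℚ (suc n) * h) b-a (*-monoˡ-< 0<h lt)))

infix  4 _<ᴿ_ _≤ᴿ_

_<ᴿ_ : ℝ → ℝ → Set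
x <ᴿ y = ∃[ q ] upper x q × lower y q

-- For Dedekind cuts this is equivalent to upper y ⊆ upper x and to ¬ (y <ᴿ x).
_≤ᴿ_ : ℝ → ℝ → Set
x ≤ᴿ y = ∀ q → lower x q → lower y q

fromℚ : ℚ → ℝ
fromℚ r .lower q = q < r
fromℚ r .upper q = r < q
fromℚ r .lower-inhabited = r - 1ℚ , <-by 1ℚ 0<1
  (solve 1 (λ r → r :- con 1ℚ :+ con 1ℚ := r) refl r)
fromℚ r .upper-inhabited = r + 1ℚ , <-by 1ℚ 0<1 refl
fromℚ r .lower-closed = <-trans
fromℚ r .upper-closed p<q r<p = <-trans r<p p<q
fromℚ r .lower-open p<r with <-dense p<r
... | q , p<q , q<r = q , p<q , q<r
fromℚ r .upper-open r<q with <-dense r<q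
... | p , r<p , p<q = p , p<q , r<p
fromℚ r .disjoint q<r r<q = <-asym q<r r<q
fromℚ r .located {p} {q} p<q with p <? r
... | yes p<r = inj₁ p<r
... | no  p≮r = inj₂ (≤-<-trans (≮⇒≥ p≮r) p<q)

fromℕ : ℕ → ℝ
fromℕ n = fromℚ (ℕ→ℚ n)

0ᴿ : ℝ
0ᴿ = fromℚ 0ℚ

fromℕ-pos : ∀ {n} → 0 ℕ.< n → 0ᴿ <ᴿ fromℕ n
fromℕ-pos {n} 0<n =
  let q , 0<q , q<n = <-dense {0ℚ} {ℕ→ℚ n} (ℕ→ℚ-mono-< {0} {n} 0<n) in q , 0<q , q<n

private
  neg-*-≤ : ∀ {r p q} → r ≤ 0ℚ → p ≤ q → r * q ≤ r * p
  neg-*-≤ {r} r≤0 = *-monoˡ-≤-nonPos r {{nonPositive r≤0}}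

  neg-*-≤ʳ : ∀ {r p q} → r ≤ 0ℚ → p ≤ q → q * r ≤ p * r
  neg-*-≤ʳ {r} r≤0 = *-monoʳ-≤-nonPos r {{nonPositive r≤0}}

  corner-≤ : ∀ {a b c d x y q} → a ≤ x → x ≤ b → c ≤ y → y ≤ d →
             q < a * c → q < a * d → q < b * c → q < b * d → q < x * y
  corner-≤ {a} {b} {y = y} a≤x x≤b c≤y y≤d ac ad bc bd with ≤-total 0ℚ y
  ... | inj₁ 0≤y with ≤-total 0ℚ a
  ...   | inj₁ 0≤a = <-≤-trans ac (≤-trans (*-monoʳ-≤ 0≤a c≤y) (*-monoˡ-≤ 0≤y a≤x))
  ...   | inj₂ a≤0 = <-≤-trans ad (≤-trans (neg-*-≤ a≤0 y≤d) (*-monoˡ-≤ 0≤y a≤x))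
  corner-≤ {a} {b} {y = y} a≤x x≤b c≤y y≤d ac ad bc bd
      | inj₂ y≤0 with ≤-total 0ℚ b
  ...   | inj₁ 0≤b = <-≤-trans bc (≤-trans (*-monoʳ-≤ 0≤b c≤y) (neg-*-≤ʳ y≤0 x≤b))
  ...   | inj₂ b≤0 = <-≤-trans bd (≤-trans (neg-*-≤ b≤0 y≤d) (neg-*-≤ʳ y≤0 x≤b))

  corner-≥ : ∀ {a b c d x y q} → a ≤ x → x ≤ b → c ≤ y → y ≤ d →
             a * c < q → a * d < q → b * c < q → b * d < q → x * y < q
  corner-≥ {a} {b} {y = y} a≤x x≤b c≤y y≤d ac ad bc bd with ≤-total 0ℚ y
  ... | inj₁ 0≤y with ≤-total 0ℚ b
  ...   | inj₁ 0≤b = ≤-<-trans (≤-trans (*-monoˡ-≤ 0≤y x≤b) (*-monoʳ-≤ 0≤b y≤d)) bd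
  ...   | inj₂ b≤0 = ≤-<-trans (≤-trans (*-monoˡ-≤ 0≤y x≤b) (neg-*-≤ b≤0 c≤y)) bc
  corner-≥ {a} {b} {y = y} a≤x x≤b c≤y y≤d ac ad bc bd
      | inj₂ y≤0 with ≤-total 0ℚ a
  ...   | inj₁ 0≤a = ≤-<-trans (≤-trans (neg-*-≤ʳ y≤0 a≤x) (*-monoʳ-≤ 0≤a y≤d)) ad
  ...   | inj₂ a≤0 = ≤-<-trans (≤-trans (neg-*-≤ʳ y≤0 a≤x) (neg-*-≤ a≤0 c≤y)) ac

  ⊔-< : ∀ {p q r} → p < r → q < r → p ⊔ q < r
  ⊔-< {p} {q} p<r q<r with ≤-total p q
  ... | inj₁ p≤q = subst (_< _) (sym (p≤q⇒p⊔q≡q p≤q)) q<r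
  ... | inj₂ q≤p = subst (_< _) (sym (p≥q⇒p⊔q≡p q≤p)) p<r

  <-⊓ : ∀ {p q r} → r < p → r < q → r < p ⊓ q
  <-⊓ {p} {q} r<p r<q with ≤-total p q
  ... | inj₁ p≤q = subst (_ <_) (sym (p≤q⇒p⊓q≡p p≤q)) r<p
  ... | inj₂ q≤p = subst (_ <_) (sym (p≥q⇒p⊓q≡q q≤p)) r<q

  4-below : ∀ p q r s → ∃[ m ] m < p × m < q × m < r × m < s
  4-below p q r s = m - 1ℚ
    , <-≤-trans m-1<m (≤-trans (p⊓q≤p (p ⊓ q) (r ⊓ s)) (p⊓q≤p p q))
    , <-≤-trans m-1<m (≤-trans (p⊓q≤p (p ⊓ q) (r ⊓ s)) (p⊓q≤q p q))
    , <-≤-trans m-1<m (≤-trans (p⊓q≤q (p ⊓ q) (r ⊓ s)) (p⊓q≤p r s))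
    , <-≤-trans m-1<m (≤-trans (p⊓q≤q (p ⊓ q) (r ⊓ s)) (p⊓q≤q r s))
    where
    m = (p ⊓ q) ⊓ (r ⊓ s)
    m-1<m : m - 1ℚ < m
    m-1<m = <-by 1ℚ 0<1 (solve 1 (λ r → r :- con 1ℚ :+ con 1ℚ := r) refl m)

  4-above : ∀ p q r s → ∃[ m ] p < m × q < m × r < m × s < m
  4-above p q r s = m + 1ℚ
    , ≤-<-trans (≤-trans (p≤p⊔q p q) (p≤p⊔q (p ⊔ q) (r ⊔ s))) m<m+1
    , ≤-<-trans (≤-trans (p≤q⊔p p q) (p≤p⊔q (p ⊔ q) (r ⊔ s))) m<m+1
    , ≤-<-trans (≤-trans (p≤p⊔q r s) (p≤q⊔p (p ⊔ q) (r ⊔ s))) m<m+1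
    , ≤-<-trans (≤-trans (p≤q⊔p r s) (p≤q⊔p (p ⊔ q) (r ⊔ s))) m<m+1
    where
    m = (p ⊔ q) ⊔ (r ⊔ s)
    m<m+1 : m < m + 1ℚ
    m<m+1 = <-by 1ℚ 0<1 refl

  4-dense-below : ∀ q a b c d → q < a → q < b → q < c → q < d →
                  ∃[ r ] q < r × r < a × r < b × r < c × r < d
  4-dense-below q a b c d q<a q<b q<c q<d =
    let r , q<r , r<m = <-dense (<-⊓ {a ⊓ b} {c ⊓ d} (<-⊓ {a} {b} q<a q<b) (<-⊓ {c} {d} q<c q<d))
    in r , q<r
     , <-≤-trans r<m (≤-trans (p⊓q≤p (a ⊓ b) (c ⊓ d)) (p⊓q≤p a b))
     , <-≤-trans r<m (≤-trans (p⊓q≤p (a ⊓ b) (c ⊓ d)) (p⊓q≤q a b))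
     , <-≤-trans r<m (≤-trans (p⊓q≤q (a ⊓ b) (c ⊓ d)) (p⊓q≤p c d))
     , <-≤-trans r<m (≤-trans (p⊓q≤q (a ⊓ b) (c ⊓ d)) (p⊓q≤q c d))

  4-dense-above : ∀ q a b c d → a < q → b < q → c < q → d < q →
                  ∃[ r ] r < q × a < r × b < r × c < r × d < r
  4-dense-above q a b c d a<q b<q c<q d<q =
    let r , m<r , r<q = <-dense (⊔-< {a ⊔ b} {c ⊔ d} (⊔-< {a} {b} a<q b<q) (⊔-< {c} {d} c<q d<q))
    in r , r<q
     , ≤-<-trans (≤-trans (p≤p⊔q a b) (p≤p⊔q (a ⊔ b) (c ⊔ d))) m<r
     , ≤-<-trans (≤-trans (p≤q⊔p a b) (p≤p⊔q (a ⊔ b) (c ⊔ d))) m<r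
     , ≤-<-trans (≤-trans (p≤p⊔q c d) (p≤q⊔p (a ⊔ b) (c ⊔ d))) m<r
     , ≤-<-trans (≤-trans (p≤q⊔p c d) (p≤q⊔p (a ⊔ b) (c ⊔ d))) m<r

  common-point : ∀ a a′ b b′ → a < b → a < b′ → a′ < b → a′ < b′ →
            ∃[ u ] a ≤ u × a′ ≤ u × u ≤ b × u ≤ b′
  common-point a a′ b b′ a<b a<b′ a′<b a′<b′ with ≤-total a a′
  ... | inj₁ a≤a′ = a′ , a≤a′ , ≤-refl , <⇒≤ a′<b , <⇒≤ a′<b′
  ... | inj₂ a′≤a = a , ≤-refl , a′≤a , <⇒≤ a<b , <⇒≤ a<b′

  magnitude : ∀ r₀ r h → h ≤ 1ℚ → r < r₀ + 1ℚ → r₀ < r + h → ∣ r ∣ ≤ ∣ r₀ ∣ + 1ℚ + 1ℚ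
  magnitude r₀ r h h≤1 r<r₀+1 r₀<r+h with ∣p∣≡p∨∣p∣≡-p r
  ... | inj₁ eq = subst (_≤ ∣ r₀ ∣ + 1ℚ + 1ℚ) (sym eq) (≤-trans (<⇒≤ r<r₀+1)
          (≤-trans (+-monoˡ-≤ 1ℚ (p≤∣p∣ r₀)) (≤-by 1ℚ (<⇒≤ 0<1) refl)))
  ... | inj₂ eq = subst (_≤ ∣ r₀ ∣ + 1ℚ + 1ℚ) (sym eq) (≤-trans
          (≤-by (r + 1ℚ - r₀)
            (0≤q-p (≤-trans (<⇒≤ r₀<r+h) (+-monoʳ-≤ r h≤1)))
            (solve 2 (λ r s → :- r :+ (r :+ con 1ℚ :- s) := :- s :+ con 1ℚ) refl r r₀))
          (≤-trans (+-monoˡ-≤ 1ℚ (-p≤∣p∣ r₀)) (≤-by 1ℚ (<⇒≤ 0<1) refl)))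

  near : ∀ M h δ u → 0ℚ < h → ∣ u ∣ ≤ M → M * h < δ → u * h < δ × - (u * h) < δ
  near M h δ u 0<h u≤M Mh<δ =
      ≤-<-trans (*-monoˡ-≤ (<⇒≤ 0<h) (≤-trans (p≤∣p∣ u) u≤M)) Mh<δ
    , subst (_< δ) (sym (neg-distribˡ-* u h))
        (≤-<-trans (*-monoˡ-≤ (<⇒≤ 0<h) (≤-trans (-p≤∣p∣ u) u≤M)) Mh<δ)

  above : ∀ p δ m v → p + δ ≤ m → - v < δ → p < m + v
  above p δ m v mid≤m -v<δ = <-≤-trans (<-by (δ - (- v)) (0<q-p -v<δ)
    (solve 3 (λ p d v → p :+ (d :- (:- v)) := p :+ d :+ v) refl p δ v)) (+-monoˡ-≤ v mid≤m)

  below : ∀ q δ mid m v → mid + δ ≡ q → m ≤ mid → v < δ → m + v < q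
  below q δ mid m v refl m≤mid v<δ = +-mono-≤-< m≤mid v<δ

  Corners : (ℚ → Set) → (a c h : ℚ) → Set
  Corners P a c h = P (a * c) × P (a * (c + h)) × P ((a + h) * c) × P ((a + h) * (c + h))

  corners-near : ∀ p q δ A C h a c → 0ℚ < δ → p + δ + δ ≡ q → 0ℚ < h → h ≤ 1ℚ →
    (A + C + 1ℚ) * h < δ → ∣ a ∣ ≤ A → ∣ c ∣ ≤ C →
    Corners (p <_) a c h ⊎ Corners (_< q) a c h
  corners-near p q δ A C h a c 0<δ mid+δ 0<h h≤1 small ∣a∣≤A ∣c∣≤C = result
    where
    M = A + C + 1ℚ
    ad≡ : a * (c + h) ≡ a * c + a * h
    ad≡ = *-distribˡ-+ a c h
    bc≡ : (a + h) * c ≡ a * c + c * h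
    bc≡ = solve 3 (λ a c h → (a :+ h) :* c := a :* c :+ c :* h) refl a c h
    bd≡ : (a + h) * (c + h) ≡ a * c + (a + c + h) * h
    bd≡ = solve 3 (λ a c h → (a :+ h) :* (c :+ h) := a :* c :+ (a :+ c :+ h) :* h) refl a c h
    0≤A : 0ℚ ≤ A
    0≤A = ≤-trans (0≤∣p∣ a) ∣a∣≤A
    0≤C : 0ℚ ≤ C
    0≤C = ≤-trans (0≤∣p∣ c) ∣c∣≤C
    near-a : a * h < δ × - (a * h) < δ
    near-a = near M h δ a 0<h (≤-trans ∣a∣≤A
      (≤-by {A} {M} (C + 1ℚ) (0≤+ 0≤C (<⇒≤ 0<1)) (sym (+-assoc A C 1ℚ)))) small
    near-c : c * h < δ × - (c * h) < δ
    near-c = near M h δ c 0<h (≤-trans ∣c∣≤C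
      (≤-by {C} {M} (A + 1ℚ) (0≤+ 0≤A (<⇒≤ 0<1))
        (solve 2 (λ A C → C :+ (A :+ con 1ℚ) := A :+ C :+ con 1ℚ) refl A C))) small
    near-u : (a + c + h) * h < δ × - ((a + c + h) * h) < δ
    near-u = near M h δ (a + c + h) 0<h (≤-trans (∣p+q∣≤∣p∣+∣q∣ (a + c) h)
      (+-mono-≤ (≤-trans (∣p+q∣≤∣p∣+∣q∣ a c) (+-mono-≤ ∣a∣≤A ∣c∣≤C))
        (subst (_≤ 1ℚ) (sym (0≤p⇒∣p∣≡p (<⇒≤ 0<h))) h≤1))) small
    result : Corners (p <_) a c h ⊎ Corners (_< q) a c h
    result with ≤-total (p + δ) (a * c)
    ... | inj₁ mid≤m = inj₁
      ( <-≤-trans (<-by {p} {p + δ} δ 0<δ refl) mid≤m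
      , subst (p <_) (sym ad≡) (above p δ (a * c) (a * h) mid≤m (proj₂ near-a))
      , subst (p <_) (sym bc≡) (above p δ (a * c) (c * h) mid≤m (proj₂ near-c))
      , subst (p <_) (sym bd≡) (above p δ (a * c) ((a + c + h) * h) mid≤m (proj₂ near-u)))
    ... | inj₂ m≤mid = inj₂
      ( ≤-<-trans m≤mid (<-by {p + δ} {q} δ 0<δ mid+δ)
      , subst (_< q) (sym ad≡) (below q δ (p + δ) (a * c) (a * h) mid+δ m≤mid (proj₁ near-a))
      , subst (_< q) (sym bc≡) (below q δ (p + δ) (a * c) (c * h) mid+δ m≤mid (proj₁ near-c))
      , subst (_< q) (sym bd≡) (below q δ (p + δ) (a * c) ((a + c + h) * h) mid+δ m≤mid (proj₁ near-u)))

  abstract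
    small-corners : ∀ {p q} → p < q → ∀ A C → ∃[ h ] 0ℚ < h × h ≤ 1ℚ ×
      (∀ a c → ∣ a ∣ ≤ A → ∣ c ∣ ≤ C → Corners (p <_) a c h ⊎ Corners (_< q) a c h)
    small-corners {p} {q} p<q A C =
      let 0<δ = 0<* (0<q-p p<q) 0<½
          n , small = archimedean (A + C + 1ℚ) 0<δ
      in 1/1+ n , 0<1/1+ n , 1/1+≤1 n , λ a c →
         corners-near p q ((q - p) * ½) A C (1/1+ n) a c 0<δ
           (solve 2 (λ p q → p :+ (q :- p) :* con ½ :+ (q :- p) :* con ½ := q) refl p q)
           (0<1/1+ n) (1/1+≤1 n) small

infixl 7 _*ᴿ_

_*ᴿ_ : ℝ → ℝ → ℝ
(x *ᴿ y) .lower q = ∃[ a ] ∃[ b ] ∃[ c ] ∃[ d ]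
  lower x a × upper x b × lower y c × upper y d ×
  q < a * c × q < a * d × q < b * c × q < b * d
(x *ᴿ y) .upper q = ∃[ a ] ∃[ b ] ∃[ c ] ∃[ d ]
  lower x a × upper x b × lower y c × upper y d ×
  a * c < q × a * d < q × b * c < q × b * d < q
(x *ᴿ y) .lower-inhabited =
  let a , La = lower-inhabited x ; b , Ub = upper-inhabited x
      c , Lc = lower-inhabited y ; d , Ud = upper-inhabited y
      q , lts = 4-below (a * c) (a * d) (b * c) (b * d)
  in q , a , b , c , d , La , Ub , Lc , Ud , lts
(x *ᴿ y) .upper-inhabited =
  let a , La = lower-inhabited x ; b , Ub = upper-inhabited x
      c , Lc = lower-inhabited y ; d , Ud = upper-inhabited y
      q , lts = 4-above (a * c) (a * d) (b * c) (b * d)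
  in q , a , b , c , d , La , Ub , Lc , Ud , lts
(x *ᴿ y) .lower-closed p<q (a , b , c , d , La , Ub , Lc , Ud , ac , ad , bc , bd) =
  a , b , c , d , La , Ub , Lc , Ud ,
  <-trans p<q ac , <-trans p<q ad , <-trans p<q bc , <-trans p<q bd
(x *ᴿ y) .upper-closed p<q (a , b , c , d , La , Ub , Lc , Ud , ac , ad , bc , bd) =
  a , b , c , d , La , Ub , Lc , Ud ,
  <-trans ac p<q , <-trans ad p<q , <-trans bc p<q , <-trans bd p<q
(x *ᴿ y) .lower-open {p} (a , b , c , d , La , Ub , Lc , Ud , ac , ad , bc , bd) =
  let q , p<q , lts = 4-dense-below p (a * c) (a * d) (b * c) (b * d) ac ad bc bd
  in q , p<q , a , b , c , d , La , Ub , Lc , Ud , lts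
(x *ᴿ y) .upper-open {p} (a , b , c , d , La , Ub , Lc , Ud , ac , ad , bc , bd) =
  let q , q<p , lts = 4-dense-above p (a * c) (a * d) (b * c) (b * d) ac ad bc bd
  in q , q<p , a , b , c , d , La , Ub , Lc , Ud , lts
(x *ᴿ y) .disjoint {q}
  (a , b , c , d , La , Ub , Lc , Ud , ac , ad , bc , bd)
  (a′ , b′ , c′ , d′ , La′ , Ub′ , Lc′ , Ud′ , ac′ , ad′ , bc′ , bd′) =
  let u , a≤u , a′≤u , u≤b , u≤b′ = common-point a a′ b b′
        (lower<upper x La Ub) (lower<upper x La Ub′) (lower<upper x La′ Ub) (lower<upper x La′ Ub′)
      v , c≤v , c′≤v , v≤d , v≤d′ = common-point c c′ d d′
        (lower<upper y Lc Ud) (lower<upper y Lc Ud′) (lower<upper y Lc′ Ud) (lower<upper y Lc′ Ud′)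
  in <-asym {q} {u * v}
       (corner-≤ {a} {b} {c} {d} {u} {v} {q} a≤u u≤b c≤v v≤d ac ad bc bd)
       (corner-≥ {a′} {b′} {c′} {d′} {u} {v} {q} a′≤u u≤b′ c′≤v v≤d′ ac′ ad′ bc′ bd′)
(x *ᴿ y) .located {p} {q} p<q =
  let a₀ , La₀ , Ua₀ = approximation x 0<1
      c₀ , Lc₀ , Uc₀ = approximation y 0<1
      h , 0<h , h≤1 , corners = small-corners p<q (∣ a₀ ∣ + 1ℚ + 1ℚ) (∣ c₀ ∣ + 1ℚ + 1ℚ)
      a , La , Ub = approximation x 0<h
      c , Lc , Ud = approximation y 0<h
      ∣a∣≤ = magnitude a₀ a h h≤1 (lower<upper x La Ua₀) (lower<upper x La₀ Ub)
      ∣c∣≤ = magnitude c₀ c h h≤1 (lower<upper y Lc Uc₀) (lower<upper y Lc₀ Ud)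
  in Sum.map (λ lts → a , a + h , c , c + h , La , Ub , Lc , Ud , lts)
             (λ lts → a , a + h , c , c + h , La , Ub , Lc , Ud , lts)
             (corners a c ∣a∣≤ ∣c∣≤)

private
  square-+ : ∀ p s i → 0ℚ < i → i ≤ 1ℚ → (p + p + 1ℚ) * i < s - p * p → (p + i) * (p + i) < s
  square-+ p s i 0<i i≤1 small = ≤-<-trans
    (≤-by (i * (1ℚ - i)) (0≤* (<⇒≤ 0<i) (0≤q-p i≤1))
      (solve 2 (λ p i → (p :+ i) :* (p :+ i) :+ i :* (con 1ℚ :- i)
        := p :* p :+ (p :+ p :+ con 1ℚ) :* i) refl p i))
    (subst (p * p + (p + p + 1ℚ) * i <_) (p+[q-p] (p * p) s) (+-monoʳ-< (p * p) small))

  square-- : ∀ q s i → 0ℚ < q → 0ℚ < i → (q + q + 1ℚ) * i < q → (q + q + 1ℚ) * i < q * q - s →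
             q - i < q × 0ℚ < q - i × s < (q - i) * (q - i)
  square-- q s i 0<q 0<i small₁ small₂ =
      <-by i 0<i (solve 2 (λ q i → q :- i :+ i := q) refl q i)
    , 0<q-p (≤-<-trans (≤-by ((q + q) * i) (0≤* (0≤+ (<⇒≤ 0<q) (<⇒≤ 0<q)) (<⇒≤ 0<i))
        (solve 2 (λ q i → i :+ (q :+ q) :* i := (q :+ q :+ con 1ℚ) :* i) refl q i)) small₁)
    , <-by (q * q - s - (q + q + 1ℚ) * i + (i + i * i))
        (0<+ (0<q-p small₂) (0≤+ (<⇒≤ 0<i) (0≤* (<⇒≤ 0<i) (<⇒≤ 0<i))))
        (solve 3 (λ s q i → s :+ (q :* q :- s :- (q :+ q :+ con 1ℚ) :* i :+ (i :+ i :* i))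
          := (q :- i) :* (q :- i)) refl s q i)

  abstract
    exceeded-by-square : ∀ b → ∃[ B ] 0ℚ < B × b < B * B
    exceeded-by-square b = 1ℚ + ∣ b ∣ , 0<B , ≤-<-trans (p≤∣p∣ b)
      (<-by (1ℚ + ∣ b ∣ + ∣ b ∣ * ∣ b ∣) (0<+ 0<B (0≤* (0≤∣p∣ b) (0≤∣p∣ b)))
        (solve 1 (λ b → b :+ (con 1ℚ :+ b :+ b :* b) := (con 1ℚ :+ b) :* (con 1ℚ :+ b)) refl ∣ b ∣))
      where
      0<B : 0ℚ < 1ℚ + ∣ b ∣
      0<B = 0<+ 0<1 (0≤∣p∣ b)

    square-above : ∀ p s → p * p < s → ∃[ q ] p < q × q * q < s
    square-above p s p²<s =
      let n , small = archimedean (p + p + 1ℚ) (0<q-p p²<s)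
      in p + 1/1+ n , <-by (1/1+ n) (0<1/1+ n) refl , square-+ p s (1/1+ n) (0<1/1+ n) (1/1+≤1 n) small

    square-below : ∀ q s → 0ℚ < q → s < q * q → ∃[ p ] p < q × 0ℚ < p × s < p * p
    square-below q s 0<q s<q² =
      let n , small = archimedean (q + q + 1ℚ) (<-⊓ {q} {q * q - s} 0<q (0<q-p s<q²))
      in q - 1/1+ n , square-- q s (1/1+ n) 0<q (0<1/1+ n)
           (<-≤-trans small (p⊓q≤p q (q * q - s))) (<-≤-trans small (p⊓q≤q q (q * q - s)))

-- For x < 0 this is 0.
√ : ℝ → ℝ
√ x .lower q = q < 0ℚ ⊎ lower x (q * q)
√ x .upper q = 0ℚ < q × upper x (q * q)
√ x .lower-inhabited = - 1ℚ , inj₁ (neg-antimono-< 0<1)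
√ x .upper-inhabited =
  let b , Ub = upper-inhabited x
      B , 0<B , b<B² = exceeded-by-square b
  in B , 0<B , upper-closed x b<B² Ub
√ x .lower-closed p<q (inj₁ q<0) = inj₁ (<-trans p<q q<0)
√ x .lower-closed {p} p<q (inj₂ Lq²) with p <? 0ℚ
... | yes p<0 = inj₁ p<0
... | no  p≮0 = inj₂ (lower-closed x (square-< (≮⇒≥ p≮0) p<q) Lq²)
√ x .upper-closed p<q (0<p , Up²) =
  <-trans 0<p p<q , upper-closed x (square-< (<⇒≤ 0<p) p<q) Up²
√ x .lower-open (inj₁ p<0) =
  let q , p<q , q<0 = <-dense p<0 in q , p<q , inj₁ q<0
√ x .lower-open {p} (inj₂ Lp²) =
  let s , p²<s , Ls = lower-open x Lp²
      q , p<q , q²<s = square-above p s p²<s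
  in q , p<q , inj₂ (lower-closed x q²<s Ls)
√ x .upper-open {q} (0<q , Uq²) =
  let s , s<q² , Us = upper-open x Uq²
      p , p<q , 0<p , s<p² = square-below q s 0<q s<q²
  in p , p<q , 0<p , upper-closed x s<p² Us
√ x .disjoint (inj₁ q<0) (0<q , _) = <-asym q<0 0<q
√ x .disjoint (inj₂ Lq²) (_ , Uq²) = disjoint x Lq² Uq²
√ x .located {p} p<q with p <? 0ℚ
... | yes p<0 = inj₁ (inj₁ p<0)
... | no  p≮0 with located x (square-< (≮⇒≥ p≮0) p<q)
...   | inj₁ Lp² = inj₁ (inj₂ Lp²)
...   | inj₂ Uq² = inj₂ (≤-<-trans (≮⇒≥ p≮0) p<q , Uq²)

-- With N = n + 1, the rationals lo n r = (1 + r/N)ᴺ and 1 / hi n r = (1 − r/N)⁻ᴺ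
-- converge to eʳ from below and from above as soon as 1 ± r/N is positive; so
-- q <exp r means q < eʳ and q >exp r means q > eʳ.
record _<exp_ (q r : ℚ) : Set where
  constructor mk<exp
  field
    index  : ℕ
    base≥0 : 0ℚ ≤ 1ℚ + r * 1/1+ index
    <power : q < lo index r

record _>exp_ (q r : ℚ) : Set where
  constructor mk>exp
  field
    index    : ℕ
    base>0   : 0ℚ < 1ℚ - r * 1/1+ index
    1<*power : 1ℚ < q * hi index r

infix 4 _<exp_ _>exp_

private
  some-above : ∀ H → 0ℚ < H → ∃[ q ] 1ℚ < q * H
  some-above H 0<H =
    let v , 0<v , Hv≡1 = inverse 0<H
    in v + 1ℚ , <-by H 0<H (trans (cong (_+ H) (sym Hv≡1))
         (solve 2 (λ h v → h :* v :+ h := (v :+ con 1ℚ) :* h) refl H v))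

  closed-above : ∀ p q H → 0ℚ < H → p < q → 1ℚ < p * H → 1ℚ < q * H
  closed-above p q H 0<H p<q 1<pH = <-trans 1<pH (*-monoˡ-< 0<H p<q)

  dense-above : ∀ q H → 0ℚ < H → 1ℚ < q * H → ∃[ p ] p < q × 1ℚ < p * H
  dense-above q H 0<H 1<qH =
    let v , 0<v , Hv≡1 = inverse 0<H
        m , 1<m , m<qH = <-dense 1<qH
    in m * v
     , subst (m * v <_)
         (trans (*-assoc q H v) (trans (cong (q *_) Hv≡1) (*-identityʳ q)))
         (*-monoˡ-< 0<v m<qH)
     , subst (1ℚ <_)
         (sym (trans (*-assoc m v H)
           (trans (cong (m *_) (trans (*-comm v H) Hv≡1)) (*-identityʳ m)))) 1<m

  not-both : ∀ q L H → q < L → 0ℚ < H → 1ℚ < q * H → L * H ≤ 1ℚ → ⊥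
  not-both q L H q<L 0<H 1<qH LH≤1 =
    <-irrefl refl (<-≤-trans (<-trans 1<qH (*-monoˡ-< 0<H q<L)) LH≤1)

  tolerance : ∀ p q → 0ℚ ≤ p → p < q →
              ∃[ ε ] 0ℚ < ε × (∀ r → q * (1ℚ + (r - (r + ε)) - ε) ≡ p)
  tolerance p q 0≤p p<q =
    let v , 0<v , qv≡1 = inverse (≤-<-trans 0≤p p<q)
    in (q - p) * ½ * v , 0<* (0<* (0<q-p p<q) 0<½) 0<v , λ r → trans
         (solve 4 (λ p q r v →
             q :* (con 1ℚ :+ (r :- (r :+ (q :- p) :* con ½ :* v)) :- (q :- p) :* con ½ :* v)
             := q :- (q :- p) :* (q :* v)) refl p q r v)
         (trans (cong (λ w → q - (q - p) * w) qv≡1)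
           (solve 2 (λ p q → q :- (q :- p) :* con 1ℚ := p) refl p q))

  either : ∀ p q L H g → 0ℚ < q → 0ℚ ≤ L → q * g ≡ p → g < L * H → p < L ⊎ 1ℚ < q * H
  either p q L H g 0<q 0≤L qg≡p g<LH with p <? L | 1ℚ <? q * H
  ... | yes p<L | _        = inj₁ p<L
  ... | no  _   | yes 1<qH = inj₂ 1<qH
  ... | no  p≮L | no  1≮qH = ⊥-elim (<-irrefl qg≡p (<-≤-trans (*-monoʳ-< 0<q g<LH)
          (≤-trans (≤-reflexive (solve 3 (λ q l h → q :* (l :* h) := l :* (q :* h)) refl q L H))
            (≤-trans (*-monoʳ-≤ 0≤L (≮⇒≥ 1≮qH))
              (subst (_≤ p) (sym (*-identityʳ L)) (≮⇒≥ p≮L))))))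

  separate : ∀ L H → 0ℚ < H → 1ℚ < L * H → ∃[ u ] ∃[ v ] 1ℚ < u * H × u < v × v < L
  separate L H 0<H 1<LH =
    let v , v<L , 1<vH = dense-above L H 0<H 1<LH
        u , u<v , 1<uH = dense-above v H 0<H 1<vH
    in u , v , 1<uH , u<v , v<L

  abstract
    exp>-1 : ∀ r → - 1ℚ <exp r
    exp>-1 r =
      let n , 0<b , _ = lo*hi-large r r 0<1
      in mk<exp n (<⇒≤ 0<b) (<-≤-trans (neg-antimono-< 0<1) (0≤^ (<⇒≤ 0<b) (suc n)))

    exp-bounded : ∀ r → ∃[ q ] q >exp r
    exp-bounded r =
      let n , _ , 0<b , _ = lo*hi-large r r 0<1
          q , 1<qH = some-above (hi n r) (0<^ 0<b (suc n))
      in q , mk>exp n 0<b 1<qH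

    <exp-closed : ∀ {p q r} → p < q → q <exp r → p <exp r
    <exp-closed p<q (mk<exp n 0≤b q<lo) = mk<exp n 0≤b (<-trans p<q q<lo)

    >exp-closed : ∀ {p q r} → p < q → p >exp r → q >exp r
    >exp-closed {p} {q} {r} p<q (mk>exp n 0<b 1<pH) =
      mk>exp n 0<b (closed-above p q (hi n r) (0<^ 0<b (suc n)) p<q 1<pH)

    <exp-open : ∀ {p r} → p <exp r → ∃[ q ] p < q × q <exp r
    <exp-open (mk<exp n 0≤b p<lo) =
      let q , p<q , q<lo = <-dense p<lo in q , p<q , mk<exp n 0≤b q<lo

    >exp-open : ∀ {q r} → q >exp r → ∃[ p ] p < q × p >exp r
    >exp-open {q} {r} (mk>exp n 0<b 1<qH) =
      let p , p<q , 1<pH = dense-above q (hi n r) (0<^ 0<b (suc n)) 1<qH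
      in p , p<q , mk>exp n 0<b 1<pH

    exp-disjoint : ∀ {q r s} → r < s → q <exp r → q >exp s → ⊥
    exp-disjoint {q} {r} {s} r<s (mk<exp n 0≤a q<lo) (mk>exp m 0<b 1<qH) =
      not-both q (lo n r) (hi m s) q<lo (0<^ 0<b (suc m)) 1<qH
        (lo*hi≤1 n m (<⇒≤ r<s) 0≤a (<⇒≤ 0<b))

    exp-located : ∀ {p q} → p < q → ∃[ ε ] 0ℚ < ε × (∀ r → p <exp r ⊎ q >exp (r + ε))
    exp-located {p} {q} p<q with p <? 0ℚ
    ... | yes p<0 = 1ℚ , 0<1 , λ r →
      let n , 0<b , _ = lo*hi-large r r 0<1
      in inj₁ (mk<exp n (<⇒≤ 0<b) (<-≤-trans p<0 (0≤^ (<⇒≤ 0<b) (suc n))))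
    ... | no  p≮0 =
      let 0≤p = ≮⇒≥ p≮0
          ε , 0<ε , gap≡ = tolerance p q 0≤p p<q
      in ε , 0<ε , λ r →
         let n , 0<a , 0<b , gap = lo*hi-large r (r + ε) 0<ε
         in Sum.map (mk<exp n (<⇒≤ 0<a)) (mk>exp n 0<b)
              (either p q (lo n r) (hi n (r + ε)) (1ℚ + (r - (r + ε)) - ε)
                (≤-<-trans 0≤p p<q) (0≤^ (<⇒≤ 0<a) (suc n)) (gap≡ r) gap)

    -- exp (- 1 / e) < e
    exp-small : ∀ e → 0ℚ < e → ∃[ r ] e >exp r
    exp-small e 0<e =
      let v , 0<v , ev≡1 = inverse 0<e
      in - v , mk>exp 0
         (subst (0ℚ <_) (solve 1 (λ v → con 1ℚ :+ v := con 1ℚ :- (:- v) :* con 1ℚ) refl v)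
           (0<+ 0<1 (<⇒≤ 0<v)))
         (<-by e 0<e (trans (cong (_+ e) (sym ev≡1))
           (solve 2 (λ e v → e :* v :+ e := e :* ((con 1ℚ :- (:- v) :* con 1ℚ) :* con 1ℚ)) refl e v)))

    exp-large : ∀ b → 0ℚ < b → b <exp b
    exp-large b 0<b = mk<exp 0
      (subst (0ℚ ≤_) (solve 1 (λ b → con 1ℚ :+ b := con 1ℚ :+ b :* con 1ℚ) refl b)
          (0≤+ (<⇒≤ 0<1) (<⇒≤ 0<b)))
      (<-by 1ℚ 0<1 (solve 1 (λ b → b :+ con 1ℚ := (con 1ℚ :+ b :* con 1ℚ) :* con 1ℚ) refl b))

    exp-separate : ∀ p q → p < q → ∃[ u ] ∃[ v ] u >exp p × u < v × v <exp q
    exp-separate p q p<q =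
      let n , 0<a , 0<b , gap = lo*hi-large q p (0<q-p p<q)
          1<LH = subst (_< lo n q * hi n p)
            (solve 2 (λ p q → con 1ℚ :+ (q :- p) :- (q :- p) := con 1ℚ) refl p q) gap
          u , v , 1<uH , u<v , v<L = separate (lo n q) (hi n p) (0<^ 0<b (suc n)) 1<LH
      in u , v , mk>exp n 0<b 1<uH , u<v , mk<exp n (<⇒≤ 0<a) v<L

exp : ℝ → ℝ
exp x .lower q = ∃[ r ] lower x r × q <exp r
exp x .upper q = ∃[ r ] upper x r × q >exp r
exp x .lower-inhabited =
  let r , Lr = lower-inhabited x in - 1ℚ , r , Lr , exp>-1 r
exp x .upper-inhabited =
  let r , Ur = upper-inhabited x
      q , q>e = exp-bounded r
  in q , r , Ur , q>e
exp x .lower-closed p<q (r , Lr , q<e) = r , Lr , <exp-closed p<q q<e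
exp x .upper-closed p<q (r , Ur , p>e) = r , Ur , >exp-closed p<q p>e
exp x .lower-open (r , Lr , p<e) =
  let q , p<q , q<e = <exp-open p<e in q , p<q , r , Lr , q<e
exp x .upper-open (r , Ur , q>e) =
  let p , p<q , p>e = >exp-open q>e in p , p<q , r , Ur , p>e
exp x .disjoint (r , Lr , q<e) (s , Us , q>e) =
  exp-disjoint (lower<upper x Lr Us) q<e q>e
exp x .located p<q =
  let ε , 0<ε , either-side = exp-located p<q
      r , Lr , Us = approximation x 0<ε
  in Sum.map (λ p<e → r , Lr , p<e) (λ q>e → r + ε , Us , q>e) (either-side r)

log : (x : ℝ) → 0ᴿ <ᴿ x → ℝ
log x 0<x .lower q = exp (fromℚ q) <ᴿ x
log x 0<x .upper q = x <ᴿ exp (fromℚ q)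
log x (e , 0<e , Le) .lower-inhabited =
  let r , e>exp = exp-small e 0<e
      q , q<r = lower-inhabited (fromℚ r)
  in q , e , (r , q<r , e>exp) , Le
log x (e , 0<e , Le) .upper-inhabited =
  let b , Ub = upper-inhabited x
      q , b<q = upper-inhabited (fromℚ b)
  in q , b , Ub , (b , b<q , exp-large b (<-trans 0<e (lower<upper x Le Ub)))
log x _ .lower-closed p<q (u , (r , q<r , u>e) , Lu) = u , (r , <-trans p<q q<r , u>e) , Lu
log x _ .upper-closed p<q (u , Uu , (r , r<p , u<e)) = u , Uu , (r , <-trans r<p p<q , u<e)
log x _ .lower-open (u , (r , p<r , u>e) , Lu) =
  let q , p<q , q<r = <-dense p<r in q , p<q , u , (r , q<r , u>e) , Lu
log x _ .upper-open (u , Uu , (r , r<q , u<e)) =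
  let p , r<p , p<q = <-dense r<q in p , p<q , u , Uu , (r , r<p , u<e)
log x _ .disjoint {q} (u , Uu , Lu) (v , Uv , Lv) =
  <-asym (lower<upper x Lu Uv) (lower<upper (exp (fromℚ q)) Lv Uu)
log x _ .located p<q =
  let q′ , p<q′ , q′<q = <-dense p<q
      p′ , p<p′ , p′<q′ = <-dense p<q′
      u , v , u>e , u<v , v<e = exp-separate p′ q′ p′<q′
  in Sum.map (λ Lu → u , (p′ , p<p′ , u>e) , Lu)
             (λ Uv → v , Uv , (q′ , q′<q , v<e))
             (located x u<v)

-- The vertices 1, …, n are the elements of Fin n with their usual order.
record OrderedGraph (n : ℕ) : Set₁ where
  field
    _~_      : Rel (Fin n) 0ℓ
    _~?_     : Decidable _~_
    ~-sym    : Symmetric _~_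
    ~-irrefl : Irreflexive _≡_ _~_

open OrderedGraph public using (_~_)

-- Each edge is listed once, with its smaller endpoint first.
edges : ∀ {n} → OrderedGraph n → List (Fin n × Fin n)
edges {n} G = filter (λ (u , v) → u Fin.<? v ×-dec OrderedGraph._~?_ G u v)
                     (cartesianProduct (allFin n) (allFin n))

record OrderedPath {n} (G : OrderedGraph n) (s : ℕ) : Set where
  field
    vertex     : Fin (suc s) → Fin n
    increasing : ∀ (i : Fin s) → vertex (inject₁ i) Fin.< vertex (Fin.suc i)
    adjacent   : ∀ (i : Fin s) → _~_ G (vertex (inject₁ i)) (vertex (Fin.suc i))

Monochromatic : ∀ {n b s} {G : OrderedGraph n} → (Fin n → Fin b) → OrderedPath G s → Set
Monochromatic χ P = ∀ i j → χ (vertex i) ≡ χ (vertex j)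
  where open OrderedPath P

{-# OPTIONS --safe #-}
module Submission where

open import Defs
open import Data.Empty using (⊥-elim)
open import Data.Fin.Base as Fin using (Fin; combine; inject₁; toℕ)
import Data.Fin.Properties as Fin
open import Data.List.Base
  using (List; []; _∷_; [_]; _++_; length; map; filter; take; drop; allFin;
         cartesianProduct; cartesianProductWith)
import Data.List.Properties as List
open import Data.List.Membership.Propositional using (_∈_; find)
import Data.List.Membership.DecPropositional as DecMembership
open import Data.List.Membership.Propositional.Properties
open import Data.List.Relation.Binary.Sublist.Propositional
  using (_⊆_; []; _∷_; _∷ʳ_; from∈; ⊆-refl; ⊆-trans)
open import Data.List.Relation.Binary.Sublist.Propositional.Properties
  using (All-resp-⊆; ++⁺; filter-⊆; take-⊆; drop-⊆)
open import Data.List.Relation.Unary.All as All using (All; []; _∷_)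
open import Data.List.Relation.Unary.All.Properties as All using (all-filter)
open import Data.List.Relation.Unary.AllPairs using (AllPairs; []; _∷_)
import Data.List.Relation.Unary.AllPairs.Properties as AllPairs
open import Data.List.Relation.Unary.Any using (Any; here; there)
open import Data.List.Relation.Unary.Unique.Propositional using (Unique)
import Data.List.Relation.Unary.Unique.Propositional.Properties as Unique
open import Data.Nat.Base as ℕ using (ℕ; zero; suc; _≤_; z≤n; s≤s)
open import Data.Nat.ListAction using (sum)
import Data.Nat.Properties as ℕ
open import Data.Nat.Properties using (<⇒≤)
open import Data.Nat.Solver using () renaming (module +-*-Solver to ℕS)
open import Data.Product.Base using (Σ-syntax; ∃-syntax; _×_; _,_; proj₁; proj₂)
open import Data.Product.Properties using (≡-dec)
open import Data.Rational.Base as ℚ using (ℚ; 0ℚ; 1ℚ; ½)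
import Data.Rational.Properties as ℚ
open import Data.Rational.Solver using () renaming (module +-*-Solver to ℚS)
open import Data.Sum.Base using (_⊎_; inj₁; inj₂; swap)
open import Function.Base using (_∘_)
open import Relation.Binary.PropositionalEquality
  using (_≡_; refl; sym; trans; cong; cong₂; subst; subst₂)
open import Relation.Nullary.Decidable
  using (Dec; yes; no; ¬?; from-yes; _×-dec_; _⊎-dec_)
open import Relation.Unary using (Decidable)

-- Blow up every vertex of a graph G into a clique on m vertices, and replace every
-- edge by a sparse bipartite graph in which any two sets of at least r = m / 3b
-- vertices are joined by an edge. Give each vertex of G the majority colour of its
-- clique. A monochromatic path of G then lifts to one that is about r times longer:
-- in each clique it enters at a low vertex of the majority colour, runs through
-- all the middle ones and leaves from a high one. A greedy choice of edges
-- yields bipartite graphs with m · O(b²) edges, so a blow-up costs a factor m bᴼ⁽¹⁾.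
-- Starting from a single vertex, t ≈ √log s blow-ups with r = 2ᵗ give paths of length s
-- at the cost of s · bᴼ⁽ᵗ⁾ edges.

-- Lists, sublists and counting.

private
  variable
    A B : Set

-- Cutting one occurrence of the head out of `ys` keeps every element of the tail, because the tail
-- avoids the head.
Unique-⊆⇒length≤ : ∀ {xs ys : List A} → Unique xs → (∀ {x} → x ∈ xs → x ∈ ys) →
                   length xs ≤ length ys
Unique-⊆⇒length≤ {xs = []} _ _ = z≤n
Unique-⊆⇒length≤ {xs = x ∷ xs} (x∉xs ∷ xs!) xs⊆ys with ∈-∃++ (xs⊆ys (here refl))
... | as , bs , refl = begin
  suc (length xs)           ≤⟨ s≤s (Unique-⊆⇒length≤ xs! shrink) ⟩
  suc (length (as ++ bs))   ≡⟨ cong suc (List.length-++ as) ⟩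
  suc (length as ℕ.+ length bs) ≡⟨ sym (ℕ.+-suc (length as) (length bs)) ⟩
  length as ℕ.+ suc (length bs) ≡⟨ sym (List.length-++ as) ⟩
  length (as ++ x ∷ bs) ∎
  where
  open ℕ.≤-Reasoning
  shrink : ∀ {z} → z ∈ xs → z ∈ as ++ bs
  shrink z∈xs with ∈-++⁻ as (xs⊆ys (there z∈xs))
  ... | inj₁ z∈as         = ∈-++⁺ˡ z∈as
  ... | inj₂ (here refl)  = ⊥-elim (All.lookup x∉xs z∈xs refl)
  ... | inj₂ (there z∈bs) = ∈-++⁺ʳ as z∈bs

length-cartesianProductWith : ∀ {C : Set} (f : A → B → C) xs ys →
  length (cartesianProductWith f xs ys) ≡ length xs ℕ.* length ys
length-cartesianProductWith f []       ys = refl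
length-cartesianProductWith f (x ∷ xs) ys = trans (List.length-++ (map (f x) ys))
  (cong₂ ℕ._+_ (List.length-map (f x) ys) (length-cartesianProductWith f xs ys))

length-allFin : ∀ n → length (allFin n) ≡ n
length-allFin n = List.length-tabulate _

length-filter-complement : ∀ {P : A → Set} (P? : Decidable P) xs →
  length (filter P? xs) ℕ.+ length (filter (¬? ∘ P?) xs) ≡ length xs
length-filter-complement P? [] = refl
length-filter-complement P? (x ∷ xs) with P? x
... | yes _ = cong suc (length-filter-complement P? xs)
... | no  _ = trans (ℕ.+-suc _ _) (cong suc (length-filter-complement P? xs))

AllPairs-resp-⊆ : ∀ {R : A → A → Set} {xs ys} → xs ⊆ ys → AllPairs R ys → AllPairs R xs
AllPairs-resp-⊆ []         []        = []
AllPairs-resp-⊆ (_ ∷ʳ τ)   (_ ∷ rs)  = AllPairs-resp-⊆ τ rs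
AllPairs-resp-⊆ (refl ∷ τ) (r ∷ rs)  = All-resp-⊆ τ r ∷ AllPairs-resp-⊆ τ rs

sublists : List A → List (List A)
sublists []       = [ [] ]
sublists (x ∷ xs) = sublists xs ++ map (x ∷_) (sublists xs)

length-sublists : (xs : List A) → length (sublists xs) ≡ 2 ℕ.^ length xs
length-sublists []       = refl
length-sublists (x ∷ xs) = trans (List.length-++ (sublists xs)) (cong₂ ℕ._+_ (length-sublists xs)
  (trans (List.length-map (x ∷_) (sublists xs))
    (trans (length-sublists xs) (sym (ℕ.+-identityʳ _)))))

⊆⇒∈-sublists : ∀ {xs ys : List A} → xs ⊆ ys → xs ∈ sublists ys
⊆⇒∈-sublists []         = here refl
⊆⇒∈-sublists (_ ∷ʳ τ)   = ∈-++⁺ˡ (⊆⇒∈-sublists τ)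
⊆⇒∈-sublists (refl ∷ τ) = ∈-++⁺ʳ _ (∈-map⁺ _ (⊆⇒∈-sublists τ))

∈-sublists⇒⊆ : ∀ {xs} (ys : List A) → xs ∈ sublists ys → xs ⊆ ys
∈-sublists⇒⊆ []       (here refl) = []
∈-sublists⇒⊆ (y ∷ ys) xs∈ with ∈-++⁻ (sublists ys) xs∈
... | inj₁ xs∈′ = y ∷ʳ ∈-sublists⇒⊆ ys xs∈′
... | inj₂ xs∈′ with ∈-map⁻ _ xs∈′
...   | _ , zs∈ , refl = refl ∷ ∈-sublists⇒⊆ ys zs∈

-- Averaging and greedy hitting sets.

∑ : (A → ℕ) → List A → ℕ
∑ f xs = sum (map f xs)

-- Averaging in constructive form: if no term reaches `k`, then each `q * f x + 1` is at most `k`,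
-- and the ones add up to the summand `length xs` that keeps the inequality strict.
some-large-or-sum-small : ∀ q k (f : A → ℕ) xs →
  Any (λ x → k ≤ q ℕ.* f x) xs ⊎ (q ℕ.* ∑ f xs ℕ.+ length xs ≤ k ℕ.* length xs)
some-large-or-sum-small q k f [] = inj₂ (ℕ.≤-reflexive
  (trans (ℕ.+-identityʳ (q ℕ.* 0)) (trans (ℕ.*-zeroʳ q) (sym (ℕ.*-zeroʳ k)))))
some-large-or-sum-small q k f (x ∷ xs) with k ℕ.≤? q ℕ.* f x | some-large-or-sum-small q k f xs
... | yes k≤qfx | _         = inj₁ (here k≤qfx)
... | no  _     | inj₁ any  = inj₁ (there any)
... | no  k≰qfx | inj₂ ∑≤   = inj₂ (begin
  q ℕ.* (f x ℕ.+ ∑ f xs) ℕ.+ suc (length xs)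
    ≡⟨ ℕS.solve 4 (λ q y z l → q :* (y :+ z) :+ (con 1 :+ l) := (con 1 :+ q :* y) :+ (q :* z :+ l))
         refl q (f x) (∑ f xs) (length xs) ⟩
  suc (q ℕ.* f x) ℕ.+ (q ℕ.* ∑ f xs ℕ.+ length xs)
    ≤⟨ ℕ.+-mono-≤ (ℕ.≰⇒> k≰qfx) ∑≤ ⟩
  k ℕ.+ k ℕ.* length xs
    ≡⟨ sym (ℕ.*-suc k (length xs)) ⟩
  k ℕ.* suc (length xs) ∎)
  where
  open ℕ.≤-Reasoning
  open ℕS using (_:+_; _:*_; _:=_; con)

module _ {E P : Set} {Hit : E → P → Set} (hit? : ∀ e p → Dec (Hit e p)) where

  hitters : List E → P → List E
  hitters es p = filter (λ e → hit? e p) es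

  targets : List P → E → List P
  targets ps e = filter (hit? e) ps

  ∑-targets-∷ : ∀ es p ps → ∑ (length ∘ targets (p ∷ ps)) es ≡
                length (hitters es p) ℕ.+ ∑ (length ∘ targets ps) es
  ∑-targets-∷ []       p ps = refl
  ∑-targets-∷ (e ∷ es) p ps with hit? e p
  ... | yes _ = cong suc (trans (cong (length (targets ps e) ℕ.+_) (∑-targets-∷ es p ps))
    (ℕS.solve 3 (λ a b c → a :+ (b :+ c) := b :+ (a :+ c)) refl
      (length (targets ps e)) (length (hitters es p)) _))
    where open ℕS using (_:+_; _:=_)
  ... | no  _ = trans (cong (length (targets ps e) ℕ.+_) (∑-targets-∷ es p ps))
    (ℕS.solve 3 (λ a b c → a :+ (b :+ c) := b :+ (a :+ c)) refl
      (length (targets ps e)) (length (hitters es p)) _)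
    where open ℕS using (_:+_; _:=_)

  -- The incidences between `es` and `ps` are counted from both sides; each `p` accounts for at
  -- least a 1/q fraction of `es`.
  double-counting : ∀ q es ps → (∀ {p} → p ∈ ps → length es ≤ q ℕ.* length (hitters es p)) →
    length ps ℕ.* length es ≤ q ℕ.* ∑ (length ∘ targets ps) es
  double-counting q es []       dense = z≤n
  double-counting q es (p ∷ ps) dense = begin
    length es ℕ.+ length ps ℕ.* length es
      ≤⟨ ℕ.+-mono-≤ (dense (here refl)) (double-counting q es ps (dense ∘ there)) ⟩
    q ℕ.* length (hitters es p) ℕ.+ q ℕ.* ∑ (length ∘ targets ps) es
      ≡⟨ sym (ℕ.*-distribˡ-+ q (length (hitters es p)) _) ⟩
    q ℕ.* (length (hitters es p) ℕ.+ ∑ (length ∘ targets ps) es)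
      ≡⟨ cong (q ℕ.*_) (sym (∑-targets-∷ es p ps)) ⟩
    q ℕ.* ∑ (length ∘ targets (p ∷ ps)) es ∎
    where open ℕ.≤-Reasoning

  -- If every `e` fell short, the strict averaging bound would contradict `double-counting`, as `es`
  -- is nonempty. Serves both the greedy choice of edges and the majority colour.
  popular : ∀ q es ps → 1 ≤ length es →
    (∀ {p} → p ∈ ps → length es ≤ q ℕ.* length (hitters es p)) →
    ∃[ e ] length ps ≤ q ℕ.* length (targets ps e)
  popular q es ps es≢[] dense with some-large-or-sum-small q (length ps) (length ∘ targets ps) es
  ... | inj₁ any = let e , _ , large = find any in e , large
  ... | inj₂ small = ⊥-elim (ℕ.<-irrefl refl (ℕ.≤-trans
    (ℕ.≤-trans (ℕ.+-mono-≤ es≢[] (double-counting q es ps dense))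
       (ℕ.≤-reflexive (ℕ.+-comm (length es) _))) small))

  -- Greedily, one of the es hits a 1/q fraction of the targets still missed.
  hitting-set : ∀ q′ es T ps → 1 ≤ length es →
    (∀ {p} → p ∈ ps → length es ≤ suc q′ ℕ.* length (hitters es p)) →
    length ps ℕ.* q′ ℕ.^ T ℕ.< suc q′ ℕ.^ T →
    ∃[ hs ] length hs ≤ T × (∀ {p} → p ∈ ps → ∃[ e ] e ∈ hs × Hit e p)
  -- With no rounds left, the hypothesis says that `length ps` is below 1.
  hitting-set q′ es zero [] _ _ _ = [] , z≤n , λ ()
  hitting-set q′ es zero (_ ∷ _) _ _ (s≤s ())
  hitting-set q′ es (suc T) ps es≢[] dense few =
    let hs , hs≤T , hits = hitting-set q′ es T missed es≢[]
          (dense ∘ proj₁ ∘ ∈-filter⁻ (¬? ∘ hit? e)) fewer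
    in e ∷ hs , s≤s hs≤T , λ {p} p∈ps → case-hit hits p∈ps (hit? e p)
    where
    open ℕ.≤-Reasoning
    e,large = popular (suc q′) es ps es≢[] dense
    e = proj₁ e,large
    missed = filter (¬? ∘ hit? e) ps
    #hit = length (targets ps e)
    case-hit : ∀ {hs p} → (∀ {p} → p ∈ missed → ∃[ e ] e ∈ hs × Hit e p) → p ∈ ps →
               Dec (Hit e p) → ∃[ e′ ] e′ ∈ e ∷ hs × Hit e′ p
    case-hit hits p∈ps (yes h) = e , here refl , h
    case-hit hits p∈ps (no ¬h) =
      let e′ , e′∈ , h = hits (∈-filter⁺ (¬? ∘ hit? e) p∈ps ¬h) in e′ , there e′∈ , h
    -- One round leaves at most a fraction q′/(q′+1) of the targets, which preserves the hypothesis
    -- with one round fewer.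
    shrunk : suc q′ ℕ.* length missed ≤ q′ ℕ.* length ps
    shrunk = ℕ.+-cancelˡ-≤ (length ps) _ _ (begin
      length ps ℕ.+ suc q′ ℕ.* length missed
        ≤⟨ ℕ.+-monoˡ-≤ _ (proj₂ e,large) ⟩
      suc q′ ℕ.* #hit ℕ.+ suc q′ ℕ.* length missed
        ≡⟨ sym (ℕ.*-distribˡ-+ (suc q′) #hit _) ⟩
      suc q′ ℕ.* (#hit ℕ.+ length missed)
        ≡⟨ cong (suc q′ ℕ.*_) (length-filter-complement (hit? e) ps) ⟩
      length ps ℕ.+ q′ ℕ.* length ps ∎)
    fewer : length missed ℕ.* q′ ℕ.^ T ℕ.< suc q′ ℕ.^ T
    fewer = ℕ.*-cancelˡ-< (suc q′) _ _ (begin-strict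
      suc q′ ℕ.* (length missed ℕ.* q′ ℕ.^ T)   ≡⟨ sym (ℕ.*-assoc (suc q′) (length missed) _) ⟩
      suc q′ ℕ.* length missed ℕ.* q′ ℕ.^ T     ≤⟨ ℕ.*-monoˡ-≤ (q′ ℕ.^ T) shrunk ⟩
      q′ ℕ.* length ps ℕ.* q′ ℕ.^ T             ≡⟨ cong (ℕ._* q′ ℕ.^ T) (ℕ.*-comm q′ (length ps)) ⟩
      length ps ℕ.* q′ ℕ.* q′ ℕ.^ T             ≡⟨ ℕ.*-assoc (length ps) q′ _ ⟩
      length ps ℕ.* q′ ℕ.^ suc T                <⟨ few ⟩
      suc q′ ℕ.^ suc T ∎)

-- Exponential decay of the greedy process.

-- Bernoulli's inequality 1 + k/p ≤ (1 + 1/p)^k, cleared of denominators.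
bernoulli-ℕ : ∀ p k → p ℕ.^ k ℕ.* (p ℕ.+ k) ≤ suc p ℕ.^ k ℕ.* p
bernoulli-ℕ p zero = ℕ.≤-reflexive (cong (1 ℕ.*_) (ℕ.+-identityʳ p))
bernoulli-ℕ p (suc k) = begin
  p ℕ.* p ℕ.^ k ℕ.* (p ℕ.+ suc k)
    ≤⟨ ℕ.m≤m+n _ (p ℕ.^ k ℕ.* k) ⟩
  p ℕ.* p ℕ.^ k ℕ.* (p ℕ.+ suc k) ℕ.+ p ℕ.^ k ℕ.* k
    ≡⟨ ℕS.solve 3 (λ p k x → p :* x :* (p :+ (con 1 :+ k)) :+ x :* k
         := (con 1 :+ p) :* (x :* (p :+ k))) refl p k (p ℕ.^ k) ⟩
  suc p ℕ.* (p ℕ.^ k ℕ.* (p ℕ.+ k))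
    ≤⟨ ℕ.*-monoʳ-≤ (suc p) (bernoulli-ℕ p k) ⟩
  suc p ℕ.* (suc p ℕ.^ k ℕ.* p)
    ≡⟨ sym (ℕ.*-assoc (suc p) (suc p ℕ.^ k) p) ⟩
  suc p ℕ.* suc p ℕ.^ k ℕ.* p ∎
  where
  open ℕ.≤-Reasoning
  open ℕS using (_:+_; _:*_; _:=_; con)

2*p^[1+p]≤[1+p]^[1+p] : ∀ p → 2 ℕ.* p ℕ.^ suc p ≤ suc p ℕ.^ suc p
2*p^[1+p]≤[1+p]^[1+p] p = begin
  2 ℕ.* (p ℕ.* p ℕ.^ p)
    ≡⟨ ℕS.solve 2 (λ p x → con 2 :* (p :* x) := x :* (p :+ p)) refl p (p ℕ.^ p) ⟩
  p ℕ.^ p ℕ.* (p ℕ.+ p)     ≤⟨ bernoulli-ℕ p p ⟩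
  suc p ℕ.^ p ℕ.* p         ≤⟨ ℕ.*-monoʳ-≤ (suc p ℕ.^ p) (ℕ.n≤1+n p) ⟩
  suc p ℕ.^ p ℕ.* suc p     ≡⟨ ℕ.*-comm (suc p ℕ.^ p) (suc p) ⟩
  suc p ℕ.^ suc p ∎
  where
  open ℕ.≤-Reasoning
  open ℕS using (_:+_; _:*_; _:=_; con)

^-distribʳ-* : ∀ m n k → (m ℕ.* n) ℕ.^ k ≡ m ℕ.^ k ℕ.* n ℕ.^ k
^-distribʳ-* m n zero    = refl
^-distribʳ-* m n (suc k) = trans (cong (m ℕ.* n ℕ.*_) (^-distribʳ-* m n k))
  (ℕS.solve 4 (λ m n x y → m :* n :* (x :* y) := m :* x :* (n :* y)) refl m n (m ℕ.^ k) (n ℕ.^ k))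
  where open ℕS using (_:*_; _:=_)

-- Every p + 1 rounds at rate 1/(p+1) at least halve what is missed, so (p+1)k rounds dispose of
-- fewer than 2^k targets.
2^k*p^[[1+p]*k]≤[1+p]^[[1+p]*k] : ∀ p k →
  2 ℕ.^ k ℕ.* p ℕ.^ (suc p ℕ.* k) ≤ suc p ℕ.^ (suc p ℕ.* k)
2^k*p^[[1+p]*k]≤[1+p]^[[1+p]*k] p k = begin
  2 ℕ.^ k ℕ.* p ℕ.^ (suc p ℕ.* k)     ≡⟨ cong (2 ℕ.^ k ℕ.*_) (sym (ℕ.^-*-assoc p (suc p) k)) ⟩
  2 ℕ.^ k ℕ.* (p ℕ.^ suc p) ℕ.^ k     ≡⟨ sym (^-distribʳ-* 2 (p ℕ.^ suc p) k) ⟩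
  (2 ℕ.* p ℕ.^ suc p) ℕ.^ k           ≤⟨ ℕ.^-monoˡ-≤ k (2*p^[1+p]≤[1+p]^[1+p] p) ⟩
  (suc p ℕ.^ suc p) ℕ.^ k             ≡⟨ ℕ.^-*-assoc (suc p) (suc p) k ⟩
  suc p ℕ.^ (suc p ℕ.* k) ∎
  where open ℕ.≤-Reasoning

-- Sparse bipartite graphs joining all large sets.

-- `H` is read as a bipartite graph between two copies of `Fin m`. Vertex sets are sublists of
-- `allFin m`, hence duplicate-free and enumerated by `sublists`.
Joins : ∀ {m} → ℕ → List (Fin m × Fin m) → Set
Joins {m} r H = ∀ {A B} → A ⊆ allFin m → B ⊆ allFin m → r ≤ length A → r ≤ length B →
  Σ[ e ∈ Fin m × Fin m ] e ∈ H × proj₁ e ∈ A × proj₂ e ∈ B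

module _ (k r : ℕ) (1≤r : 1 ≤ r) where

  private
    -- The form `suc (suc k)` makes `q′` positive and lets `suc q′` reduce to `K * K`.
    K = suc (suc k)
    m = K ℕ.* r
    q′ = ℕ.pred (K ℕ.* K)
    universe = cartesianProduct (allFin m) (allFin m)
    large? : Decidable {A = List (Fin m) × List (Fin m)} (λ (A , B) → r ≤ length A × r ≤ length B)
    large? (A , B) = r ℕ.≤? length A ×-dec r ℕ.≤? length B
    pairs = cartesianProduct (sublists (allFin m)) (sublists (allFin m))

  -- The targets of `hitting-set` are the pairs (A , B) of large sets. Each contains at least r² of
  -- the m² = K²r² possible edges, so the rate is 1/K², and there are at most 2^(2m) targets.
  sparse-bipartite :
    Σ[ H ∈ List (Fin m × Fin m) ] length H ≤ K ℕ.* K ℕ.* suc (2 ℕ.* m) × Joins r H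
  sparse-bipartite =
    let H , H≤ , hits = hitting-set hit? q′ universe (suc q′ ℕ.* suc (2 ℕ.* m)) (filter large? pairs)
          (subst (1 ≤_) (sym |universe|) (ℕ.*-mono-≤ 1≤m 1≤m)) dense few
    in H , H≤ , λ A⊆ B⊆ r≤A r≤B → hits (∈-filter⁺ large?
         (∈-cartesianProduct⁺ (⊆⇒∈-sublists A⊆) (⊆⇒∈-sublists B⊆)) (r≤A , r≤B))
    where
    open ℕ.≤-Reasoning
    open import Data.List.Membership.DecPropositional (Fin._≟_ {m}) using (_∈?_)
    hit? : ∀ (e : Fin m × Fin m) (p : List (Fin m) × List (Fin m)) →
           Dec (proj₁ e ∈ proj₁ p × proj₂ e ∈ proj₂ p)
    hit? (i , j) (A , B) = (i ∈? A) ×-dec (j ∈? B)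
    1≤m : 1 ≤ m
    1≤m = ℕ.≤-trans 1≤r (ℕ.m≤m+n r _)
    |universe| : length universe ≡ m ℕ.* m
    |universe| = trans (length-cartesianProductWith _,_ (allFin m) (allFin m))
      (cong₂ ℕ._*_ (length-allFin m) (length-allFin m))
    dense : ∀ {p} → p ∈ filter large? pairs →
            length universe ≤ suc q′ ℕ.* length (hitters hit? universe p)
    dense {A , B} p∈ with ∈-filter⁻ large? {xs = pairs} p∈
    ... | p∈pairs , r≤A , r≤B = begin
      length universe                              ≡⟨ |universe| ⟩
      K ℕ.* r ℕ.* (K ℕ.* r)                        ≡⟨ ℕ.[m*n]*[o*p]≡[m*o]*[n*p] K r K r ⟩
      K ℕ.* K ℕ.* (r ℕ.* r)                        ≤⟨ ℕ.*-monoʳ-≤ (K ℕ.* K) (ℕ.*-mono-≤ r≤A r≤B) ⟩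
      K ℕ.* K ℕ.* (length A ℕ.* length B)          ≡⟨ cong (K ℕ.* K ℕ.*_) (sym (length-cartesianProductWith _,_ A B)) ⟩
      K ℕ.* K ℕ.* length (cartesianProduct A B)    ≤⟨ ℕ.*-monoʳ-≤ (K ℕ.* K)
        (Unique-⊆⇒length≤ (Unique.cartesianProduct⁺ (unique A⊆) (unique B⊆)) ⊆hitters) ⟩
      K ℕ.* K ℕ.* length (hitters hit? universe (A , B)) ∎
      where
      AB∈ = ∈-cartesianProduct⁻ (sublists (allFin m)) (sublists (allFin m)) p∈pairs
      A⊆ = ∈-sublists⇒⊆ (allFin m) (proj₁ AB∈)
      B⊆ = ∈-sublists⇒⊆ (allFin m) (proj₂ AB∈)
      unique : ∀ {C} → C ⊆ allFin m → Unique C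
      unique C⊆ = AllPairs-resp-⊆ C⊆ (Unique.allFin⁺ m)
      ⊆hitters : ∀ {e} → e ∈ cartesianProduct A B → e ∈ hitters hit? universe (A , B)
      ⊆hitters e∈ = ∈-filter⁺ (λ e → hit? e (A , B))
        (∈-cartesianProduct⁺ (∈-allFin _) (∈-allFin _)) (∈-cartesianProduct⁻ A B e∈)
    T = suc q′ ℕ.* suc (2 ℕ.* m)
    few : length (filter large? pairs) ℕ.* q′ ℕ.^ T ℕ.< suc q′ ℕ.^ T
    few = begin-strict
      length (filter large? pairs) ℕ.* q′ ℕ.^ T
        ≤⟨ ℕ.*-monoˡ-≤ (q′ ℕ.^ T) (List.length-filter large? pairs) ⟩
      length pairs ℕ.* q′ ℕ.^ T
        ≡⟨ cong (ℕ._* q′ ℕ.^ T) |pairs| ⟩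
      2 ℕ.^ (2 ℕ.* m) ℕ.* q′ ℕ.^ T
        -- Raising 2m to 2m + 1 in the exponent gives the strictness that `hitting-set` asks for.
        <⟨ ℕ.*-monoˡ-< (q′ ℕ.^ T) {{ℕ.m^n≢0 q′ T}} (ℕ.^-monoʳ-< 2 (s≤s (s≤s z≤n)) (ℕ.n<1+n (2 ℕ.* m))) ⟩
      2 ℕ.^ suc (2 ℕ.* m) ℕ.* q′ ℕ.^ T
        ≤⟨ 2^k*p^[[1+p]*k]≤[1+p]^[[1+p]*k] q′ (suc (2 ℕ.* m)) ⟩
      suc q′ ℕ.^ T ∎
      where
      |pairs| : length pairs ≡ 2 ℕ.^ (2 ℕ.* m)
      |pairs| = trans (length-cartesianProductWith _,_ (sublists (allFin m)) (sublists (allFin m)))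
        (trans (cong₂ ℕ._*_ |sub| |sub|) (trans (sym (ℕ.^-distribˡ-+-* 2 m m))
          (cong (λ i → 2 ℕ.^ (m ℕ.+ i)) (sym (ℕ.+-identityʳ m)))))
        where
        |sub| : length (sublists (allFin m)) ≡ 2 ℕ.^ m
        |sub| = trans (length-sublists (allFin m)) (cong (2 ℕ.^_) (length-allFin m))

-- Blow-ups and lifting of monochromatic walks.

-- Walk L P u k: k vertices satisfying P, the first of which is u.
data Walk {n} (L : List (Fin n × Fin n)) (P : Fin n → Set) : Fin n → ℕ → Set where
  stop : ∀ {u} → P u → Walk L P u 1
  step : ∀ {u v k} → P u → u Fin.< v → (u , v) ∈ L → Walk L P v k → Walk L P u (suc k)

-- The number `ℓ` counts vertices, one more than the length of the path. `L` is an arbitrary list of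
-- pairs, from which `Walk` selects increasing ones.
Unavoidable : ∀ {n} → ℕ → ℕ → List (Fin n × Fin n) → Set
Unavoidable {n} b ℓ L = ∀ (χ : Fin n → Fin b) → ∃[ c ] ∃[ u ] Walk L (λ v → χ v ≡ c) u ℓ

-- `combine` is lexicographic, so the cliques are consecutive intervals in the order of the old
-- vertices. The first list places a copy of `H` over each edge; the second has all m² ordered pairs
-- of each clique, which gives its length in closed form.
blow-up : ∀ {N m} → List (Fin N × Fin N) → List (Fin m × Fin m) →
          List (Fin (N ℕ.* m) × Fin (N ℕ.* m))
blow-up {N} {m} L H =
  cartesianProductWith (λ (x , y) (i , j) → combine x i , combine y j) L H ++
  cartesianProductWith (λ x (i , j) → combine x i , combine x j)
    (allFin N) (cartesianProduct (allFin m) (allFin m))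

length-blow-up : ∀ {N m} (L : List (Fin N × Fin N)) (H : List (Fin m × Fin m)) →
  length (blow-up L H) ≡ length L ℕ.* length H ℕ.+ N ℕ.* (m ℕ.* m)
length-blow-up {N} {m} L H = trans (List.length-++ (cartesianProductWith _ L H)) (cong₂ ℕ._+_
  (length-cartesianProductWith _ L H)
  (trans (length-cartesianProductWith _ (allFin N) _) (cong₂ ℕ._*_ (length-allFin N)
    (trans (length-cartesianProductWith _,_ (allFin m) (allFin m))
      (cong₂ ℕ._*_ (length-allFin m) (length-allFin m))))))

combine-monoʳ-< : ∀ {n m} (x : Fin n) {i j : Fin m} → i Fin.< j → combine x i Fin.< combine x j
combine-monoʳ-< {n} {m} x {i} {j} i<j =
  subst₂ ℕ._<_ (sym (Fin.toℕ-combine x i)) (sym (Fin.toℕ-combine x j))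
    (ℕ.+-monoʳ-< (m ℕ.* toℕ x) i<j)

-- A lifted walk enters a clique in `low`, visits all of `mid` and leaves from `high`. The length of
-- `mid` is exact, so that lengths of walks are exact too.
record Thirds {m} (r : ℕ) (P : Fin m → Set) : Set where
  field
    low mid high : List (Fin m)
    sorted : AllPairs Fin._<_ (low ++ mid ++ high)
    all    : All P (low ++ mid ++ high)
    low⊆   : low ⊆ allFin m
    high⊆  : high ⊆ allFin m
    |low|  : r ≤ length low
    |mid|  : length mid ≡ r
    |high| : r ≤ length high

thirds : ∀ {m} r {P : Fin m → Set} (P? : Decidable P) →
         3 ℕ.* r ≤ length (filter P? (allFin m)) → Thirds r P
thirds {m} r {P} P? 3r≤ = record
  { low  = take r S ; mid = take r (drop r S) ; high = drop r (drop r S)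
  ; sorted = subst (AllPairs Fin._<_) (sym S≡)
      (AllPairs.filter⁺ P? (AllPairs.tabulate⁺-< (λ i<j → i<j)))
  ; all    = subst (All P) (sym S≡) (all-filter P? (allFin m))
  ; low⊆   = ⊆-trans (take-⊆ r S) (filter-⊆ P? (allFin m))
  ; high⊆  = ⊆-trans (drop-⊆ r (drop r S)) (⊆-trans (drop-⊆ r S) (filter-⊆ P? (allFin m)))
  ; |low|  = ℕ.≤-reflexive (sym (trans (List.length-take r S)
      (ℕ.m≤n⇒m⊓n≡m (ℕ.≤-trans (ℕ.m≤m+n r _) 3r≤))))
  ; |mid|  = trans (List.length-take r (drop r S)) (ℕ.m≤n⇒m⊓n≡m
      (ℕ.≤-trans (ℕ.m≤m+n r (r ℕ.+ 0)) 2r≤))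
  ; |high| = subst (r ≤_) (sym (List.length-drop r (drop r S)))
      (n≤o∸m (subst (λ i → r ℕ.+ i ≤ length (drop r S)) (ℕ.+-identityʳ r) 2r≤))
  }
  where
  S = filter P? (allFin m)
  n≤o∸m : ∀ {n o} → r ℕ.+ n ≤ o → n ≤ o ℕ.∸ r
  n≤o∸m {n} {o} r+n≤o = ℕ.m+n≤o⇒m≤o∸n n (subst (_≤ o) (ℕ.+-comm r n) r+n≤o)
  2r≤ : 2 ℕ.* r ≤ length (drop r S)
  2r≤ = subst (2 ℕ.* r ≤_) (sym (List.length-drop r S)) (n≤o∸m 3r≤)
  S≡ : take r S ++ take r (drop r S) ++ drop r (drop r S) ≡ S
  S≡ = trans (cong (take r S ++_) (List.take++drop≡id r (drop r S))) (List.take++drop≡id r S)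

module _ {N m r b} (L : List (Fin N × Fin N)) (H : List (Fin m × Fin m)) (1≤r : 1 ≤ r)
  (joins : Joins r H) (1≤b : 1 ≤ b) (m≡ : m ≡ b ℕ.* (3 ℕ.* r)) where

  -- All pairs within a clique are present, so any increasing list of its vertices can be walked.
  -- `P` at the last vertex `j` comes with the walk that continues from there.
  climb : ∀ {P} {x : Fin N} M {i j : Fin m} {k} → AllPairs Fin._<_ (i ∷ M ++ [ j ]) → All (P ∘ combine x) (i ∷ M) →
    Walk (blow-up L H) P (combine x j) k →
    Walk (blow-up L H) P (combine x i) (suc (length M ℕ.+ k))
  climb {P} {x} = go
    where
    inner : ∀ {i j : Fin m} → (combine x i , combine x j) ∈ blow-up L H
    inner = ∈-++⁺ʳ (cartesianProductWith _ L H) (∈-cartesianProductWith⁺ _ (∈-allFin x)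
      (∈-cartesianProduct⁺ (∈-allFin _) (∈-allFin _)))
    go : ∀ M {i j : Fin m} {k} → AllPairs Fin._<_ (i ∷ M ++ [ j ]) → All (P ∘ combine x) (i ∷ M) →
      Walk (blow-up L H) P (combine x j) k →
      Walk (blow-up L H) P (combine x i) (suc (length M ℕ.+ k))
    go []      ((i<j ∷ _) ∷ _)      (Pi ∷ _)  w = step Pi (combine-monoʳ-< x i<j) inner w
    go (_ ∷ M) ((i<l ∷ _) ∷ sorted) (Pi ∷ Ps) w =
      step Pi (combine-monoʳ-< x i<l) inner (go M sorted Ps w)

  -- The entry `i`, all of `mid` and the exit `j` form a sublist of a sorted list. Entry and exit
  -- stay free because edges of `H` prescribe them.
  cross : ∀ {P} {x : Fin N} {i j : Fin m} {k} (T : Thirds r (P ∘ combine x)) → i ∈ Thirds.low T → j ∈ Thirds.high T →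
    Walk (blow-up L H) P (combine x j) k → Walk (blow-up L H) P (combine x i) (suc (r ℕ.+ k))
  cross {P} {x} {i} {j} {k} T i∈ j∈ w = subst (λ l → Walk (blow-up L H) P (combine x i) (suc (l ℕ.+ k))) |mid|
    (climb mid (AllPairs-resp-⊆ (++⁺ (from∈ i∈) (++⁺ ⊆-refl (from∈ j∈))) sorted)
      (All.++⁻ˡ (i ∷ mid) (All-resp-⊆ (++⁺ (from∈ i∈) ⊆-refl) all)) w)
    where open Thirds T

  -- `popular` with colours hitting vertices: each vertex is hit by one of the `b` colours, so some
  -- colour has at least m/b = 3r vertices.
  majority : (χ : Fin m → Fin b) → ∃[ c ] Thirds r (λ i → χ i ≡ c)
  majority χ =
    let c , m≤ = popular hit? b (allFin b) (allFin m) (subst (1 ≤_) (sym (length-allFin b)) 1≤b)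
          (λ {i} _ → subst (_≤ b ℕ.* length (hitters hit? (allFin b) i)) (sym (length-allFin b))
            (subst (_≤ b ℕ.* length (hitters hit? (allFin b) i)) (ℕ.*-identityʳ b)
              (ℕ.*-monoʳ-≤ b (∈-length (∈-filter⁺ (λ c → hit? c i) (∈-allFin (χ i)) refl)))))
    in c , thirds r (hit? c) (ℕ.*-cancelˡ-≤ b {{ℕ.>-nonZero 1≤b}}
         (subst (_≤ b ℕ.* length (filter (hit? c) (allFin m))) (trans (length-allFin m) m≡) m≤))
    where
    hit? : ∀ (c : Fin b) (i : Fin m) → Dec (χ i ≡ c)
    hit? c i = χ i Fin.≟ c

  -- Each vertex of the walk for the majority colouring turns into r + 2 vertices: an entry, `mid`
  -- and an exit.
  blow-up-unavoidable : ∀ {ℓ} → Unavoidable b ℓ L → Unavoidable b (ℓ ℕ.* (2 ℕ.+ r)) (blow-up L H)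
  blow-up-unavoidable un χ =
    let c , x , w = un (λ x → proj₁ (maj x))
        i , i∈ = some (Thirds.|low| (proj₂ (maj x)))
    in c , combine x i , lift c w i∈
    where
    maj : ∀ x → ∃[ c ] Thirds r (λ i → χ (combine x i) ≡ c)
    maj x = majority (χ ∘ combine x)
    some : ∀ {xs : List (Fin m)} → r ≤ length xs → ∃[ i ] i ∈ xs
    some {[]}    r≤0 = ⊥-elim (ℕ.<-irrefl refl (ℕ.≤-trans 1≤r r≤0))
    some {i ∷ _} _   = i , here refl
    high-colour : ∀ {x j} → j ∈ Thirds.high (proj₂ (maj x)) → χ (combine x j) ≡ proj₁ (maj x)
    high-colour {x} j∈ = All.lookup (Thirds.all (proj₂ (maj x)))
      (∈-++⁺ʳ (Thirds.low (proj₂ (maj x))) (∈-++⁺ʳ (Thirds.mid (proj₂ (maj x))) j∈))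
    -- Stated for every low `i`, since the edge of `H` out of the preceding clique decides where the
    -- walk enters.
    lift : ∀ c {x k} → Walk L (λ y → proj₁ (maj y) ≡ c) x k →
      ∀ {i} → i ∈ Thirds.low (proj₂ (maj x)) →
      Walk (blow-up L H) (λ v → χ v ≡ c) (combine x i) (k ℕ.* (2 ℕ.+ r))
    lift .(proj₁ (maj x)) {x} (stop refl) i∈ =
      let j , j∈ = some (Thirds.|high| (proj₂ (maj x)))
      in subst (Walk _ _ _) (cong suc (ℕ.+-suc r 0))
        (cross (proj₂ (maj x)) i∈ j∈ (stop (high-colour j∈)))
    lift .(proj₁ (maj x)) {x} (step {v = y} {k} refl x<y xy∈ w) i∈ =
      let (j , i′) , ji′∈ , j∈ , i′∈ = joins
            (Thirds.high⊆ (proj₂ (maj x))) (Thirds.low⊆ (proj₂ (maj y)))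
            (Thirds.|high| (proj₂ (maj x))) (Thirds.|low| (proj₂ (maj y)))
      in subst (Walk _ _ _) (cong suc (ℕ.+-suc r _))
        (cross (proj₂ (maj x)) i∈ j∈
          (step (high-colour j∈) (Fin.combine-monoˡ-< j i′ x<y)
            (∈-++⁺ˡ (∈-cartesianProductWith⁺ _ xy∈ ji′∈)) (lift _ w i′∈)))

-- Iterating the blow-up from a single vertex.

module _ (b′ r : ℕ) (1≤r : 1 ≤ r) where

  private
    b = suc b′
    K = b ℕ.* 3
    m = K ℕ.* r
    F = suc (3 ℕ.* (K ℕ.* K))

  -- `H` has at most K²(1 + 2m) ≤ 3K²m edges, so its copies multiply the edge bound by 3K²m. The
  -- cliques add m^(t+2) pairs, which the 1 in `F` absorbs.
  iterated-blow-up : ∀ t → Σ[ N ∈ ℕ ] Σ[ L ∈ List (Fin N × Fin N) ]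
    N ≡ m ℕ.^ t × length L ≤ m ℕ.^ suc t ℕ.* F ℕ.^ t × Unavoidable b ((2 ℕ.+ r) ℕ.^ t) L
  iterated-blow-up zero = 1 , [] , refl , z≤n , λ χ → χ Fin.zero , Fin.zero , stop refl
  iterated-blow-up (suc t) =
    let N , L , N≡ , L≤ , un = iterated-blow-up t
        -- With k = 1 + 3b′, the ratio k + 2 is 3b.
        H , H≤ , joins = sparse-bipartite (suc (b′ ℕ.* 3)) r 1≤r
    in N ℕ.* m , blow-up L H , trans (cong (ℕ._* m) N≡) (ℕ.*-comm (m ℕ.^ t) m)
     , bound L H N≡ L≤ H≤
     , subst (λ ℓ → Unavoidable b ℓ (blow-up L H)) (ℕ.*-comm ((2 ℕ.+ r) ℕ.^ t) (2 ℕ.+ r))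
         (blow-up-unavoidable L H 1≤r joins (s≤s z≤n) (ℕ.*-assoc b 3 r) un)
    where
    open ℕ.≤-Reasoning
    open ℕS using (_:+_; _:*_; _:=_; con)
    1≤m : 1 ≤ m
    1≤m = ℕ.≤-trans 1≤r (ℕ.m≤m+n r _)
    bound : ∀ {N} (L : List (Fin N × Fin N)) (H : List (Fin m × Fin m)) → N ≡ m ℕ.^ t →
      length L ≤ m ℕ.^ suc t ℕ.* F ℕ.^ t → length H ≤ K ℕ.* K ℕ.* suc (2 ℕ.* m) →
      length (blow-up L H) ≤ m ℕ.^ suc (suc t) ℕ.* F ℕ.^ suc t
    bound {N} L H N≡ L≤ H≤ = begin
      length (blow-up L H)
        ≡⟨ length-blow-up L H ⟩
      length L ℕ.* length H ℕ.+ N ℕ.* (m ℕ.* m)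
        ≤⟨ ℕ.+-mono-≤ (ℕ.*-mono-≤ L≤ (ℕ.≤-trans H≤ (ℕ.*-monoʳ-≤ (K ℕ.* K) (ℕ.+-monoˡ-≤ (2 ℕ.* m) 1≤m))))
             (ℕ.≤-trans (ℕ.≤-reflexive (cong (ℕ._* (m ℕ.* m)) N≡))
                (ℕ.m≤m*n _ (F ℕ.^ t) {{ℕ.m^n≢0 F t}})) ⟩
      m ℕ.* m ℕ.^ t ℕ.* F ℕ.^ t ℕ.* (K ℕ.* K ℕ.* (m ℕ.+ 2 ℕ.* m)) ℕ.+ m ℕ.^ t ℕ.* (m ℕ.* m) ℕ.* F ℕ.^ t
        ≡⟨ ℕS.solve 4 (λ m a f q →
             m :* a :* f :* (q :* (m :+ con 2 :* m)) :+ a :* (m :* m) :* f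
             := m :* (m :* a) :* ((con 1 :+ con 3 :* q) :* f)) refl m (m ℕ.^ t) (F ℕ.^ t) (K ℕ.* K) ⟩
      m ℕ.^ suc (suc t) ℕ.* F ℕ.^ suc t ∎

-- From edge lists and walks to ordered graphs and paths.

fromEdges : ∀ {n} → List (Fin n × Fin n) → OrderedGraph n
fromEdges {n} L = record
  { _~_      = λ u v → (u Fin.< v × (u , v) ∈ L) ⊎ (v Fin.< u × (v , u) ∈ L)
  ; _~?_     = λ u v → ((u Fin.<? v) ×-dec ((u , v) ∈? L)) ⊎-dec ((v Fin.<? u) ×-dec ((v , u) ∈? L))
  ; ~-sym    = swap
  ; ~-irrefl = λ { refl (inj₁ (u<u , _)) → ℕ.<-irrefl refl u<u
                 ; refl (inj₂ (u<u , _)) → ℕ.<-irrefl refl u<u }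
  }
  where open DecMembership (≡-dec (Fin._≟_ {n}) (Fin._≟_ {n})) using (_∈?_)

-- The enumerated edges are distinct and, having their smaller endpoint first, all occur in `L`.
length-edges-fromEdges : ∀ {n} (L : List (Fin n × Fin n)) → length (edges (fromEdges L)) ≤ length L
length-edges-fromEdges {n} L = Unique-⊆⇒length≤
  (Unique.filter⁺ edge? (Unique.cartesianProduct⁺ (Unique.allFin⁺ n) (Unique.allFin⁺ n)))
  (λ e∈ → listed (proj₂ (∈-filter⁻ edge? {xs = cartesianProduct (allFin n) (allFin n)} e∈)))
  where
  G = fromEdges L
  edge? : ∀ (e : Fin n × Fin n) → Dec (proj₁ e Fin.< proj₂ e × _~_ G (proj₁ e) (proj₂ e))
  edge? (u , v) = (u Fin.<? v) ×-dec OrderedGraph._~?_ G u v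
  listed : ∀ {u v} → u Fin.< v × _~_ G u v → (u , v) ∈ L
  listed (u<v , inj₁ (_ , uv∈)) = uv∈
  listed (u<v , inj₂ (v<u , _)) = ⊥-elim (ℕ.<-asym u<v v<u)

module _ {n} {L : List (Fin n × Fin n)} {P : Fin n → Set} where

  truncate : ∀ {u k s} → suc s ≤ k → Walk L P u k → Walk L P u (suc s)
  truncate {s = zero}  _         (stop Pu)            = stop Pu
  truncate {s = zero}  _         (step Pu _ _ _)      = stop Pu
  truncate {s = suc _} (s≤s ())  (stop _)
  truncate {s = suc _} (s≤s s<k) (step Pu u<v uv∈ w)  = step Pu u<v uv∈ (truncate s<k w)

  vertexAt : ∀ {u k} → Walk L P u k → Fin k → Fin n
  vertexAt {u} (stop _)       _           = u
  vertexAt {u} (step _ _ _ _) Fin.zero    = u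
  vertexAt     (step _ _ _ w) (Fin.suc i) = vertexAt w i

  vertexAt-P : ∀ {u k} (w : Walk L P u k) i → P (vertexAt w i)
  vertexAt-P (stop Pu)       _           = Pu
  vertexAt-P (step Pu _ _ _) Fin.zero    = Pu
  vertexAt-P (step _ _ _ w)  (Fin.suc i) = vertexAt-P w i

  vertexAt-zero : ∀ {u k} (w : Walk L P u (suc k)) → vertexAt w Fin.zero ≡ u
  vertexAt-zero (stop _)       = refl
  vertexAt-zero (step _ _ _ _) = refl

  vertexAt-step : ∀ {u s} (w : Walk L P u (suc s)) (i : Fin s) →
    vertexAt w (inject₁ i) Fin.< vertexAt w (Fin.suc i) ×
    (vertexAt w (inject₁ i) , vertexAt w (Fin.suc i)) ∈ L
  vertexAt-step (step _ u<v uv∈ w) Fin.zero rewrite vertexAt-zero w = u<v , uv∈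
  vertexAt-step (step _ _ _ w@(step _ _ _ _)) (Fin.suc i) = vertexAt-step w i

  toPath : ∀ {u s} → Walk L P u (suc s) → OrderedPath (fromEdges L) s
  toPath w = record
    { vertex     = vertexAt w
    ; increasing = proj₁ ∘ vertexAt-step w
    ; adjacent   = inj₁ ∘ vertexAt-step w
    }

Arrows : ∀ {n} → OrderedGraph n → ℕ → ℕ → Set
Arrows {n} G b s = ∀ (χ : Fin n → Fin b) → Σ[ P ∈ OrderedPath G s ] Monochromatic χ P

unavoidable⇒arrows : ∀ {n b ℓ s} (L : List (Fin n × Fin n)) → suc s ≤ ℓ → Unavoidable b ℓ L →
                     Arrows (fromEdges L) b s
unavoidable⇒arrows L s<ℓ un χ =
  let c , u , w = un χ
      w′ = truncate s<ℓ w
  in toPath w′ , λ i j → trans (vertexAt-P w′ i) (sym (vertexAt-P w′ j))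

-- Choice of parameters and the edge count.

bracket : ∀ (f : ℕ → ℕ) {s} n → f 0 ≤ s → s ℕ.< f n → ∃[ w ] f w ≤ s × s ℕ.< f (suc w)
bracket f zero f0≤s s<f0 = ⊥-elim (ℕ.<-irrefl refl (ℕ.≤-trans s<f0 f0≤s))
bracket f {s} (suc n) f0≤s s<f with f n ℕ.≤? s
... | yes fn≤s = n , fn≤s , s<f
... | no  fn≰s = bracket f n f0≤s (ℕ.≰⇒> fn≰s)

n<2^n : ∀ n → n ℕ.< 2 ℕ.^ n
n<2^n zero    = s≤s z≤n
n<2^n (suc n) = ℕ.≤-trans (ℕ.+-mono-≤ (ℕ.m^n>0 2 n) (n<2^n n))
  (ℕ.≤-reflexive (cong (2 ℕ.^ n ℕ.+_) (sym (ℕ.+-identityʳ _))))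

-- `suc w` is the integer part of √(log₂ s), which is at least 1 for s ≥ 2.
square-exponent : ∀ {s} → 2 ≤ s →
  ∃[ w ] 2 ℕ.^ (suc w ℕ.* suc w) ≤ s × s ℕ.< 2 ℕ.^ (suc (suc w) ℕ.* suc (suc w))
square-exponent {s} 2≤s = bracket (λ w → 2 ℕ.^ (suc w ℕ.* suc w)) s 2≤s
  (ℕ.<-≤-trans (n<2^n s) (ℕ.^-monoʳ-≤ 2 (ℕ.≤-trans (ℕ.n≤1+n s) (ℕ.m≤m*n (suc s) (suc s)))))

module _ {b w s′ : ℕ} (2≤b : 2 ≤ b) (1≤w : 1 ≤ w) (1≤s′ : 1 ≤ s′)
         (2^w²≤s : 2 ℕ.^ (w ℕ.* w) ≤ suc s′) where
  private
    t = suc w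
    K = b ℕ.* 3
    m = K ℕ.* 2 ℕ.^ t
    F = suc (3 ℕ.* (K ℕ.* K))
    open ℕ.≤-Reasoning
    open ℕS using (_:+_; _:*_; _:=_; con)
    instance
      b≢0 : ℕ.NonZero b
      b≢0 = ℕ.>-nonZero (ℕ.≤-trans (s≤s z≤n) 2≤b)
    4≤b² : 4 ≤ b ℕ.^ 2
    4≤b² = ℕ.^-monoˡ-≤ 2 2≤b
    K≤b³ : K ≤ b ℕ.^ 3
    K≤b³ = ℕ.*-monoʳ-≤ b (ℕ.≤-trans (ℕ.n≤1+n 3) 4≤b²)
    F≤b⁸ : F ≤ b ℕ.^ 8
    F≤b⁸ = begin
      1 ℕ.+ 3 ℕ.* (K ℕ.* K)   ≤⟨ ℕ.+-mono-≤ (ℕ.m^n>0 b 6) (ℕ.*-monoʳ-≤ 3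
           (ℕ.≤-trans (ℕ.*-mono-≤ K≤b³ K≤b³) (ℕ.≤-reflexive (sym (ℕ.^-distribˡ-+-* b 3 3))))) ⟩
      4 ℕ.* b ℕ.^ 6           ≤⟨ ℕ.*-monoˡ-≤ (b ℕ.^ 6) 4≤b² ⟩
      b ℕ.^ 2 ℕ.* b ℕ.^ 6     ≡⟨ sym (ℕ.^-distribˡ-+-* b 2 6) ⟩
      b ℕ.^ 8 ∎
    -- Since t(t+1) = w² + 3w + 2, the power 2^(w²) ≤ s can be split off. Replacing s by s′ = s - 1
    -- costs a factor 2 ≤ b; the real bound later needs a rational strictly below s.
    2^≤s*b^ : 2 ℕ.^ (t ℕ.* suc t) ≤ s′ ℕ.* b ℕ.^ (3 ℕ.+ 3 ℕ.* w)
    2^≤s*b^ = begin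
      2 ℕ.^ (t ℕ.* suc t)
        ≡⟨ cong (2 ℕ.^_) (ℕS.solve 1 (λ w → (con 1 :+ w) :* (con 2 :+ w)
             := w :* w :+ (con 2 :+ con 3 :* w)) refl w) ⟩
      2 ℕ.^ (w ℕ.* w ℕ.+ (2 ℕ.+ 3 ℕ.* w))
        ≡⟨ ℕ.^-distribˡ-+-* 2 (w ℕ.* w) (2 ℕ.+ 3 ℕ.* w) ⟩
      2 ℕ.^ (w ℕ.* w) ℕ.* 2 ℕ.^ (2 ℕ.+ 3 ℕ.* w)
        ≤⟨ ℕ.*-mono-≤ (ℕ.≤-trans 2^w²≤s (ℕ.+-monoˡ-≤ s′ 1≤s′)) (ℕ.^-monoˡ-≤ (2 ℕ.+ 3 ℕ.* w) 2≤b) ⟩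
      (s′ ℕ.+ s′) ℕ.* b ℕ.^ (2 ℕ.+ 3 ℕ.* w)
        ≡⟨ ℕS.solve 2 (λ s x → (s :+ s) :* x := s :* (con 2 :* x)) refl s′ (b ℕ.^ (2 ℕ.+ 3 ℕ.* w)) ⟩
      s′ ℕ.* (2 ℕ.* b ℕ.^ (2 ℕ.+ 3 ℕ.* w))
        ≤⟨ ℕ.*-monoʳ-≤ s′ (ℕ.*-monoˡ-≤ (b ℕ.^ (2 ℕ.+ 3 ℕ.* w)) 2≤b) ⟩
      s′ ℕ.* b ℕ.^ (3 ℕ.+ 3 ℕ.* w) ∎

  -- Only the power of two depends on s. The other factors are powers of b, since 3b ≤ b³ and F ≤ b⁸
  -- for b ≥ 2, with total exponent 14w + 17 ≤ 32w.
  edge-bound : m ℕ.^ suc t ℕ.* F ℕ.^ t ≤ s′ ℕ.* b ℕ.^ (32 ℕ.* w)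
  edge-bound = begin
    (K ℕ.* 2 ℕ.^ t) ℕ.^ suc t ℕ.* F ℕ.^ t
      ≡⟨ cong (ℕ._* F ℕ.^ t) (trans (^-distribʳ-* K (2 ℕ.^ t) (suc t))
           (cong (K ℕ.^ suc t ℕ.*_) (ℕ.^-*-assoc 2 t (suc t)))) ⟩
    K ℕ.^ suc t ℕ.* 2 ℕ.^ (t ℕ.* suc t) ℕ.* F ℕ.^ t
      ≤⟨ ℕ.*-mono-≤ (ℕ.*-mono-≤ (ℕ.^-monoˡ-≤ (suc t) K≤b³) 2^≤s*b^) (ℕ.^-monoˡ-≤ t F≤b⁸) ⟩
    (b ℕ.^ 3) ℕ.^ suc t ℕ.* (s′ ℕ.* b ℕ.^ (3 ℕ.+ 3 ℕ.* w)) ℕ.* (b ℕ.^ 8) ℕ.^ t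
      ≡⟨ cong₂ (λ x y → x ℕ.* (s′ ℕ.* b ℕ.^ (3 ℕ.+ 3 ℕ.* w)) ℕ.* y)
           (ℕ.^-*-assoc b 3 (suc t)) (ℕ.^-*-assoc b 8 t) ⟩
    b ℕ.^ (3 ℕ.* suc t) ℕ.* (s′ ℕ.* b ℕ.^ (3 ℕ.+ 3 ℕ.* w)) ℕ.* b ℕ.^ (8 ℕ.* t)
      ≡⟨ ℕS.solve 4 (λ x s y z → x :* (s :* y) :* z := s :* (x :* y :* z)) refl
           (b ℕ.^ (3 ℕ.* suc t)) s′ (b ℕ.^ (3 ℕ.+ 3 ℕ.* w)) (b ℕ.^ (8 ℕ.* t)) ⟩
    s′ ℕ.* (b ℕ.^ (3 ℕ.* suc t) ℕ.* b ℕ.^ (3 ℕ.+ 3 ℕ.* w) ℕ.* b ℕ.^ (8 ℕ.* t))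
      ≡⟨ cong (s′ ℕ.*_) (sym (trans (ℕ.^-distribˡ-+-* b (3 ℕ.* suc t ℕ.+ (3 ℕ.+ 3 ℕ.* w)) (8 ℕ.* t))
           (cong (ℕ._* b ℕ.^ (8 ℕ.* t)) (ℕ.^-distribˡ-+-* b (3 ℕ.* suc t) (3 ℕ.+ 3 ℕ.* w))))) ⟩
    s′ ℕ.* b ℕ.^ (3 ℕ.* suc t ℕ.+ (3 ℕ.+ 3 ℕ.* w) ℕ.+ 8 ℕ.* t)
      ≤⟨ ℕ.*-monoʳ-≤ s′ (ℕ.^-monoʳ-≤ b (begin
           3 ℕ.* suc t ℕ.+ (3 ℕ.+ 3 ℕ.* w) ℕ.+ 8 ℕ.* t
             ≡⟨ ℕS.solve 1 (λ w → con 3 :* (con 2 :+ w) :+ (con 3 :+ con 3 :* w) :+ con 8 :* (con 1 :+ w)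
                  := con 14 :* w :+ con 17) refl w ⟩
           14 ℕ.* w ℕ.+ 17         ≤⟨ ℕ.+-monoʳ-≤ (14 ℕ.* w) (ℕ.*-mono-≤ (ℕ.n≤1+n 17) 1≤w) ⟩
           14 ℕ.* w ℕ.+ 18 ℕ.* w   ≡⟨ sym (ℕ.*-distribʳ-+ w 14 18) ⟩
           32 ℕ.* w ∎)) ⟩
    s′ ℕ.* b ℕ.^ (32 ℕ.* w) ∎

sparse-arrowing : ∀ {b w s′} → 2 ≤ b → 1 ≤ w → 1 ≤ s′ → 2 ℕ.^ (w ℕ.* w) ≤ suc s′ →
  suc s′ ℕ.< 2 ℕ.^ (suc w ℕ.* suc w) →
  Σ[ n ∈ ℕ ] Σ[ G ∈ OrderedGraph n ] length (edges G) ≤ s′ ℕ.* b ℕ.^ (32 ℕ.* w) × Arrows G b (suc s′)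
sparse-arrowing {suc b′} {w} 2≤b 1≤w 1≤s′ 2^w²≤s s<2^t² =
  let n , L , _ , L≤ , un = iterated-blow-up b′ (2 ℕ.^ suc w) (ℕ.m^n>0 2 (suc w)) (suc w)
  in n , fromEdges L
   , ℕ.≤-trans (length-edges-fromEdges L) (ℕ.≤-trans L≤ (edge-bound 2≤b 1≤w 1≤s′ 2^w²≤s))
   -- The walks have (2 + 2^t)^t ≥ 2^(t²) > s vertices, where t = w + 1.
   , unavoidable⇒arrows L (ℕ.≤-trans s<2^t² (ℕ.≤-trans
       (ℕ.≤-reflexive (sym (ℕ.^-*-assoc 2 (suc w) (suc w))))
       (ℕ.^-monoˡ-≤ (suc w) (ℕ.m≤n+m (2 ℕ.^ suc w) 2)))) un

-- One colour: a monotone path.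

pathEdges : ∀ s → List (Fin (suc s) × Fin (suc s))
pathEdges s = map (λ i → inject₁ i , Fin.suc i) (allFin s)

path-arrows : ∀ s → Arrows (fromEdges (pathEdges s)) 1 s
path-arrows s χ = record
  { vertex     = λ i → i
  ; increasing = inject₁<suc
  ; adjacent   = λ i → inj₁ (inject₁<suc i , ∈-map⁺ _ (∈-allFin i))
  } , λ i j → Fin1-unique (χ i) (χ j)
  where
  inject₁<suc : ∀ {n} (i : Fin n) → inject₁ i Fin.< Fin.suc i
  inject₁<suc i = s≤s (ℕ.≤-reflexive (Fin.toℕ-inject₁ i))
  Fin1-unique : ∀ (i j : Fin 1) → i ≡ j
  Fin1-unique Fin.zero Fin.zero = refl

length-pathEdges : ∀ s → length (edges (fromEdges (pathEdges s))) ≤ s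
length-pathEdges s = ℕ.≤-trans (length-edges-fromEdges (pathEdges s))
  (ℕ.≤-reflexive (trans (List.length-map _ (allFin s)) (length-allFin s)))

-- Arithmetic and powers in ℚ.

open ℝ

ℕ→ℚ-+ : ∀ m n → ℕ→ℚ (m ℕ.+ n) ≡ ℕ→ℚ m ℚ.+ ℕ→ℚ n
ℕ→ℚ-+ zero    n = sym (ℚ.+-identityˡ (ℕ→ℚ n))
ℕ→ℚ-+ (suc m) n = trans (ℕ→ℚ-suc (m ℕ.+ n)) (trans (cong (1ℚ ℚ.+_) (ℕ→ℚ-+ m n))
  (trans (sym (ℚ.+-assoc 1ℚ (ℕ→ℚ m) (ℕ→ℚ n))) (cong (ℚ._+ ℕ→ℚ n) (sym (ℕ→ℚ-suc m)))))

ℕ→ℚ-* : ∀ m n → ℕ→ℚ (m ℕ.* n) ≡ ℕ→ℚ m ℚ.* ℕ→ℚ n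
ℕ→ℚ-* zero    n = sym (ℚ.*-zeroˡ (ℕ→ℚ n))
ℕ→ℚ-* (suc m) n = trans (ℕ→ℚ-+ n (m ℕ.* n)) (trans (cong (ℕ→ℚ n ℚ.+_) (ℕ→ℚ-* m n))
  (trans (ℚS.solve 2 (λ m n → n :+ m :* n := (con 1ℚ :+ m) :* n) refl (ℕ→ℚ m) (ℕ→ℚ n))
    (cong (ℚ._* ℕ→ℚ n) (sym (ℕ→ℚ-suc m)))))
  where open ℚS using (_:+_; _:*_; _:=_; con)

ℕ→ℚ-^ : ∀ m n → ℕ→ℚ (m ℕ.^ n) ≡ ℕ→ℚ m ^ n
ℕ→ℚ-^ m zero    = refl
ℕ→ℚ-^ m (suc n) = trans (ℕ→ℚ-* m (m ℕ.^ n)) (cong (ℕ→ℚ m ℚ.*_) (ℕ→ℚ-^ m n))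

ℕ→ℚ-mono-≤ : ∀ {m n} → m ≤ n → ℕ→ℚ m ℚ.≤ ℕ→ℚ n
ℕ→ℚ-mono-≤ {m} {n} m≤n = ≤-by (ℕ→ℚ (n ℕ.∸ m)) (0≤ℕ→ℚ (n ℕ.∸ m))
  (trans (sym (ℕ→ℚ-+ m (n ℕ.∸ m))) (cong ℕ→ℚ (ℕ.m+[n∸m]≡n m≤n)))

^-monoˡ-< : ∀ {p q} → 0ℚ ℚ.≤ p → p ℚ.< q → ∀ n → p ^ suc n ℚ.< q ^ suc n
^-monoˡ-< {p} {q} 0≤p p<q n = ℚ.≤-<-trans
  (*-monoʳ-≤ 0≤p (^-monoˡ-≤ 0≤p (ℚ.<⇒≤ p<q) n))
  (*-monoˡ-< (0<^ (ℚ.≤-<-trans 0≤p p<q) n) p<q)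

^≤1 : ∀ {p} → 0ℚ ℚ.≤ p → p ℚ.≤ 1ℚ → ∀ n → p ^ n ℚ.≤ 1ℚ
^≤1 {p} 0≤p p≤1 n = subst (p ^ n ℚ.≤_) (1^ n) (^-monoˡ-≤ 0≤p p≤1 n)

-- Lower bounds for logarithms, products and exponentials.

¼ ⅛ ⅓ : ℚ
¼ = ½ ℚ.* ½
⅛ = ¼ ℚ.* ½
⅓ = 1/1+ 2

1<p^ : ∀ {p} → 1ℚ ℚ.< p → ∀ n → 1ℚ ℚ.< p ^ suc n
1<p^ {p} 1<p n = subst (ℚ._< p ^ suc n) (1^ (suc n)) (^-monoˡ-< (ℚ.<⇒≤ 0<1) 1<p n)

-- e^{W/4} < e^{W/3} ≤ (1 - 1/3)^{-W} < (7/4)^W < 2^W.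
exp-W/4<2^W : ∀ W {n} → 2 ℕ.^ suc W ≤ n → exp (fromℚ (ℕ→ℚ (suc W) ℚ.* ¼)) <ᴿ fromℕ n
exp-W/4<2^W W {n} 2^W≤n = u ^ suc W , (N ℚ.* ⅓ , r₀<r , mk>exp W base power) , below
  where
  N = ℕ→ℚ (suc W)
  u ⅔ : ℚ
  u = 1ℚ ℚ.+ ½ ℚ.+ ¼
  ⅔ = 1ℚ ℚ.- ⅓
  0<N : 0ℚ ℚ.< N
  0<N = ℕ→ℚ-mono-< {0} {suc W} (s≤s z≤n)
  r₀<r : N ℚ.* ¼ ℚ.< N ℚ.* ⅓
  r₀<r = *-monoʳ-< 0<N (from-yes (¼ ℚ.<? ⅓))
  base≡ : 1ℚ ℚ.- N ℚ.* ⅓ ℚ.* 1/1+ W ≡ ⅔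
  base≡ = cong (λ x → 1ℚ ℚ.- x) (trans (ℚS.solve 3 (λ n t i → n :* t :* i := t :* (n :* i)) refl N ⅓ (1/1+ W))
    (trans (cong (⅓ ℚ.*_) (suc*1/1+ W)) (ℚ.*-identityʳ ⅓)))
    where open ℚS using (_:*_; _:=_)
  base : 0ℚ ℚ.< 1ℚ ℚ.- N ℚ.* ⅓ ℚ.* 1/1+ W
  base = subst (0ℚ ℚ.<_) (sym base≡) (from-yes (0ℚ ℚ.<? ⅔))
  power : 1ℚ ℚ.< u ^ suc W ℚ.* hi W (N ℚ.* ⅓)
  power = subst (1ℚ ℚ.<_) (trans (^-distrib-* u ⅔ (suc W))
      (cong (λ x → u ^ suc W ℚ.* x ^ suc W) (sym base≡)))
    (1<p^ (from-yes (1ℚ ℚ.<? u ℚ.* ⅔)) W)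
  below : u ^ suc W ℚ.< ℕ→ℚ n
  below = ℚ.<-≤-trans (^-monoˡ-< (from-yes (0ℚ ℚ.≤? u)) (from-yes (u ℚ.<? ℕ→ℚ 2)) W)
    (subst (ℚ._≤ ℕ→ℚ n) (ℕ→ℚ-^ 2 (suc W)) (ℕ→ℚ-mono-≤ 2^W≤n))

-- For nonnegative `a` and `c`, the corner `a * c` is the least of the four that define the product.
lower-* : ∀ x y {a c q} → lower x a → lower y c → 0ℚ ℚ.≤ a → 0ℚ ℚ.≤ c → q ℚ.< a ℚ.* c →
          lower (x *ᴿ y) q
lower-* x y {a} {c} {q} La Lc 0≤a 0≤c q<ac =
  let b , Ub = upper-inhabited x
      d , Ud = upper-inhabited y
      a≤b = ℚ.<⇒≤ (lower<upper x La Ub)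
      c≤d = ℚ.<⇒≤ (lower<upper y Lc Ud)
  in a , b , c , d , La , Ub , Lc , Ud , q<ac
   , ℚ.<-≤-trans q<ac (*-monoʳ-≤ 0≤a c≤d)
   , ℚ.<-≤-trans q<ac (*-monoˡ-≤ 0≤c a≤b)
   , ℚ.<-≤-trans q<ac (*-mono-≤ 0≤a a≤b 0≤c c≤d)

-- With V = v + 1 and M = n + 1, the V-th power of (1 + r/M)^M is (1 + Vr/(VM))^(VM), again one of
-- the lower approximations, now of e^(Vr).
lower-exp-^ : ∀ X v {p r} → 0ℚ ℚ.≤ p → p <exp r → lower X (ℕ→ℚ (suc v) ℚ.* r) →
              lower (exp X) (p ^ suc v)
lower-exp-^ X v {p} {r} 0≤p (mk<exp n base p<lo) L =
  V ℚ.* r , L , mk<exp N (subst (λ x → 0ℚ ℚ.≤ 1ℚ ℚ.+ x) (sym Vrj≡ri) base)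
    (subst (p ^ suc v ℚ.<_)
      (trans (^-assocʳ (1ℚ ℚ.+ r ℚ.* i) (suc n) (suc v))
        (trans (cong ((1ℚ ℚ.+ r ℚ.* i) ^_) (ℕ.*-comm (suc n) (suc v)))
          (cong (λ x → (1ℚ ℚ.+ x) ^ suc N) (sym Vrj≡ri))))
      (^-monoˡ-< 0≤p p<lo v))
  where
  open ℚS using (_:*_; _:=_)
  -- Chosen so that `suc N` is `suc v * suc n`.
  N = n ℕ.+ v ℕ.* suc n
  V = ℕ→ℚ (suc v)
  M = ℕ→ℚ (suc n)
  i = 1/1+ n
  j = 1/1+ N
  Vrj≡ri : V ℚ.* r ℚ.* j ≡ r ℚ.* i
  Vrj≡ri = trans (sym (ℚ.*-identityʳ _)) (trans (cong (V ℚ.* r ℚ.* j ℚ.*_) (sym (suc*1/1+ n)))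
    (trans (ℚS.solve 5 (λ V r j M i → V :* r :* j :* (M :* i) := r :* i :* (V :* M :* j)) refl V r j M i)
      (trans (cong (λ x → r ℚ.* i ℚ.* (x ℚ.* j)) (sym (ℕ→ℚ-* (suc v) (suc n))))
        (trans (cong (r ℚ.* i ℚ.*_) (suc*1/1+ N)) (ℚ.*-identityʳ _)))))

-- As e^(1/4) < 2 ≤ b, log b exceeds 1/4. An approximation within 1/8 from below is then itself
-- above 1/8, so doubling it overshoots log b.
log-within-factor-2 : ∀ {b} (1≤b : 1 ≤ b) → 2 ≤ b → let l = log (fromℕ b) (fromℕ-pos 1≤b) in
  ∃[ α ] 0ℚ ℚ.< α × lower l α × upper l (α ℚ.+ α)
log-within-factor-2 {b} 1≤b 2≤b =
  let α , Lα , Uα = approximation l (from-yes (0ℚ ℚ.<? ⅛))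
      ⅛<α = <-by (α ℚ.+ ⅛ ℚ.- ¼) (0<q-p (lower<upper l (exp-W/4<2^W 0 {b} 2≤b) Uα))
              (ℚS.solve 1 (λ α → con ⅛ :+ (α :+ con ⅛ :- con ¼) := α) refl α)
  in α , ℚ.<-trans (from-yes (0ℚ ℚ.<? ⅛)) ⅛<α , Lα , upper-closed l (ℚ.+-monoʳ-< α ⅛<α) Uα
  where
  open ℚS using (_:+_; _:-_; _:=_; con)
  l = log (fromℕ b) (fromℕ-pos 1≤b)

exponent : ∀ {b s} → 1 ≤ b → 1 ≤ s → ℝ
exponent {b} {s} 1≤b 1≤s =
  fromℕ 130 *ᴿ log (fromℕ b) (fromℕ-pos 1≤b) *ᴿ √ (log (fromℕ s) (fromℕ-pos 1≤s))

-- 130 leaves room for rounding the factor down twice, to 129 and then to 128 = 4 * 32.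
b^32w<exp : ∀ {b s} w′ (1≤b : 1 ≤ b) (1≤s : 1 ≤ s) → 2 ≤ b →
  2 ℕ.^ (suc w′ ℕ.* suc w′) ≤ s →
  lower (exp (exponent 1≤b 1≤s)) (ℕ→ℚ b ^ (32 ℕ.* suc w′))
b^32w<exp {b} {s} w′ 1≤b 1≤s 2≤b 2^w²≤s =
  let α , 0<α , Lα , (u , b<u , r , r<2α , mk<exp n base u<lo) = log-within-factor-2 1≤b 2≤b
      0≤128 = 0≤ℕ→ℚ 128
      0≤128α = 0≤* 0≤128 (ℚ.<⇒≤ 0<α)
      L128α = lower-* (fromℕ 130) (log (fromℕ b) (fromℕ-pos 1≤b)) {ℕ→ℚ 129} {α} {ℕ→ℚ 128 ℚ.* α}
                (ℕ→ℚ-mono-< {129} {130} ℕ.≤-refl) Lα (0≤ℕ→ℚ 129) (ℚ.<⇒≤ 0<α)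
                (*-monoˡ-< 0<α (ℕ→ℚ-mono-< {128} {129} ℕ.≤-refl))
  -- From b < e^r with r < 2α follows b^(32w) < e^(32wr), and 32w · 2α = 128α · β. The index is 32w
  -- - 1, as `lower-exp-^` adds one.
  in lower-exp-^ (exponent 1≤b 1≤s) (w′ ℕ.+ 31 ℕ.* w) (0≤ℕ→ℚ b) (mk<exp n base (ℚ.<-trans b<u u<lo))
       (lower-* (fromℕ 130 *ᴿ log (fromℕ b) (fromℕ-pos 1≤b)) (√ (log (fromℕ s) (fromℕ-pos 1≤s)))
         L128α Lβ 0≤128α (0≤* (0≤ℕ→ℚ w) (ℚ.<⇒≤ 0<½))
         (subst (ℕ→ℚ (32 ℕ.* w) ℚ.* r ℚ.<_) (eq α) (*-monoʳ-< 0<32w r<2α)))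
  where
  open ℚS using (_:+_; _:*_; _:=_; con)
  w = suc w′
  -- w/2 is below √(log s), because e^(w²/4) < 2^(w²) ≤ s.
  β = ℕ→ℚ w ℚ.* ½
  0<32w : 0ℚ ℚ.< ℕ→ℚ (32 ℕ.* w)
  0<32w = ℕ→ℚ-mono-< {0} {32 ℕ.* w} (s≤s z≤n)
  β²≡ : ℕ→ℚ (w ℕ.* w) ℚ.* ¼ ≡ β ℚ.* β
  β²≡ = trans (cong (ℚ._* ¼) (ℕ→ℚ-* w w))
    (ℚS.solve 1 (λ w → w :* w :* con ¼ := w :* con ½ :* (w :* con ½)) refl (ℕ→ℚ w))
  Lβ : lower (√ (log (fromℕ s) (fromℕ-pos 1≤s))) β
  Lβ = inj₂ (subst (λ x → exp (fromℚ x) <ᴿ fromℕ s) β²≡ (exp-W/4<2^W (w′ ℕ.+ w′ ℕ.* w) 2^w²≤s))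
  eq : ∀ α → ℕ→ℚ (32 ℕ.* w) ℚ.* (α ℚ.+ α) ≡ ℕ→ℚ 128 ℚ.* α ℚ.* β
  eq α = trans (cong (ℚ._* (α ℚ.+ α)) (ℕ→ℚ-* 32 w))
    (ℚS.solve 2 (λ w α → con (ℕ→ℚ 32) :* w :* (α :+ α) := con (ℕ→ℚ 128) :* α :* (w :* con ½)) refl (ℕ→ℚ w) α)

-- Nonnegative reals, for the case of one colour.

-- This is `0ᴿ ≤ᴿ x`. The lower cut of log 1 = 0 has no nonnegative rational, so `lower-*` cannot
-- handle it.
NonNegativeᴿ : ℝ → Set
NonNegativeᴿ x = ∀ {q} → q ℚ.< 0ℚ → lower x q

upper-nonneg : ∀ x → NonNegativeᴿ x → ∀ {r} → upper x r → 0ℚ ℚ.≤ r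
upper-nonneg x 0≤x {r} Ur with r ℚ.<? 0ℚ
... | yes r<0 = ⊥-elim (disjoint x (0≤x r<0) Ur)
... | no  r≮0 = ℚ.≮⇒≥ r≮0

-- Both factors get the lower bound -i with (b + d)i < -q: the mixed corners -id and -bi stay above
-- `q`, and the other two are nonnegative.
*ᴿ-nonneg : ∀ x y → NonNegativeᴿ x → NonNegativeᴿ y → NonNegativeᴿ (x *ᴿ y)
*ᴿ-nonneg x y 0≤x 0≤y {q} q<0 =
  let b , Ub = upper-inhabited x
      d , Ud = upper-inhabited y
      0≤b = upper-nonneg x 0≤x Ub
      0≤d = upper-nonneg y 0≤y Ud
      n , small = archimedean (b ℚ.+ d) (ℚ.neg-antimono-< q<0)
      i = 1/1+ n
      0<i = 0<1/1+ n
      -i<0 = ℚ.neg-antimono-< 0<i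
      room = 0<q-p small
  in ℚ.- i , b , ℚ.- i , d , 0≤x -i<0 , Ub , 0≤y -i<0 , Ud
   , ℚ.<-≤-trans q<0 (0≤p*p (ℚ.- i))
   , <-by (ℚ.- q ℚ.- (b ℚ.+ d) ℚ.* i ℚ.+ b ℚ.* i) (0<+ room (0≤* 0≤b (ℚ.<⇒≤ 0<i)))
       (ℚS.solve 4 (λ q b d i → q :+ (:- q :- (b :+ d) :* i :+ b :* i) := :- i :* d) refl q b d i)
   , <-by (ℚ.- q ℚ.- (b ℚ.+ d) ℚ.* i ℚ.+ d ℚ.* i) (0<+ room (0≤* 0≤d (ℚ.<⇒≤ 0<i)))
       (ℚS.solve 4 (λ q b d i → q :+ (:- q :- (b :+ d) :* i :+ d :* i) := b :* (:- i)) refl q b d i)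
   , ℚ.<-≤-trans q<0 (0≤* 0≤b 0≤d)
  where open ℚS using (_:+_; _:*_; _:-_; :-_; _:=_)

√-nonneg : ∀ x → NonNegativeᴿ (√ x)
√-nonneg x = inj₁

-- By locatedness, the only alternative is 1 < (1 + r/N)^N for some r < 0, where the base lies
-- between 0 and 1.
log-1-nonneg : ∀ (1≤1 : 1 ≤ 1) → NonNegativeᴿ (log (fromℕ 1) (fromℕ-pos 1≤1))
log-1-nonneg 1≤1 {q} q<0 with ℚ.<-dense q<0
... | q′ , q<q′ , q′<0 with located (log (fromℕ 1) (fromℕ-pos 1≤1)) q<q′
...   | inj₁ Lq = Lq
...   | inj₂ (u , 1<u , r , r<q′ , mk<exp n base u<lo) = ⊥-elim (ℚ.<-irrefl refl
        (ℚ.<-≤-trans (ℚ.<-trans 1<u u<lo) (^≤1 base base≤1 (suc n))))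
  where
  open ℚS using (_:+_; _:*_; :-_; _:=_; con)
  base≤1 : 1ℚ ℚ.+ r ℚ.* 1/1+ n ℚ.≤ 1ℚ
  base≤1 = ≤-by (ℚ.- r ℚ.* 1/1+ n)
    (0≤* (ℚ.<⇒≤ (ℚ.neg-antimono-< (ℚ.<-trans r<q′ q′<0))) (ℚ.<⇒≤ (0<1/1+ n)))
    (ℚS.solve 2 (λ r i → con 1ℚ :+ r :* i :+ :- r :* i := con 1ℚ) refl r (1/1+ n))

-- By locatedness, the only alternative is 1 < c′(1 - r/N)^N with c′ < 1 and r ≥ 0, where no factor
-- exceeds 1.
exp-nonneg : ∀ x → NonNegativeᴿ x → ∀ {c} → c ℚ.< 1ℚ → lower (exp x) c
exp-nonneg x 0≤x {c} c<1 with ℚ.<-dense c<1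
... | c′ , c<c′ , c′<1 with located (exp x) c<c′
...   | inj₁ Lc = Lc
...   | inj₂ (r , Ur , mk>exp n base 1<c′hi) = ⊥-elim (ℚ.<-irrefl refl (ℚ.<-≤-trans 1<c′hi
        (ℚ.≤-trans (*-monoˡ-≤ (0≤^ (ℚ.<⇒≤ base) (suc n)) (ℚ.<⇒≤ c′<1))
          (subst (ℚ._≤ 1ℚ) (sym (ℚ.*-identityˡ (hi n r))) (^≤1 (ℚ.<⇒≤ base) base≤1 (suc n))))))
  where
  open ℚS using (_:+_; _:*_; _:-_; _:=_; con)
  base≤1 : 1ℚ ℚ.- r ℚ.* 1/1+ n ℚ.≤ 1ℚ
  base≤1 = ≤-by (r ℚ.* 1/1+ n) (0≤* (upper-nonneg x 0≤x Ur) (ℚ.<⇒≤ (0<1/1+ n)))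
    (ℚS.solve 2 (λ r i → con 1ℚ :- r :* i :+ r :* i := con 1ℚ) refl r (1/1+ n))

-- For q ≥ 0, take q < m < a < s and write m = a · (m/a), where m/a < 1 is below the exponential.
-- For q < 0, the factors 0 and 0 suffice.
x≤x*exp-nonneg : ∀ {s} x → 1 ≤ s → NonNegativeᴿ x → fromℕ s ≤ᴿ fromℕ s *ᴿ exp x
x≤x*exp-nonneg {s} x 1≤s 0≤x q q<s with q ℚ.<? 0ℚ
... | yes q<0 = lower-* (fromℕ s) (exp x) (ℕ→ℚ-mono-< {0} {s} 1≤s) (exp-nonneg x 0≤x 0<1) ℚ.≤-refl ℚ.≤-refl q<0
... | no  q≮0 =
  let a , q<a , a<s = ℚ.<-dense q<s
      m , q<m , m<a = ℚ.<-dense q<a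
      0≤q = ℚ.≮⇒≥ q≮0
      0<a = ℚ.≤-<-trans 0≤q q<a
      v , 0<v , av≡1 = inverse 0<a
  in lower-* (fromℕ s) (exp x) a<s
       (exp-nonneg x 0≤x (subst (m ℚ.* v ℚ.<_) av≡1 (*-monoˡ-< 0<v m<a)))
       (ℚ.<⇒≤ 0<a) (0≤* (ℚ.<⇒≤ (ℚ.≤-<-trans 0≤q q<m)) (ℚ.<⇒≤ 0<v))
       (subst (q ℚ.<_) (sym (trans
         (ℚS.solve 3 (λ a m v → a :* (m :* v) := m :* (a :* v)) refl a m v)
         (trans (cong (m ℚ.*_) av≡1) (ℚ.*-identityʳ m)))) q<m)
  where open ℚS using (_:*_; _:=_)

fromℕ-mono-≤ : ∀ {m n} → m ≤ n → fromℕ m ≤ᴿ fromℕ n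
fromℕ-mono-≤ m≤n q q<m = ℚ.<-≤-trans q<m (ℕ→ℚ-mono-≤ m≤n)

theorem1p2 : Σ[ C ∈ ℝ ] (0ᴿ <ᴿ C ×
    (∀ (b s : ℕ) (1≤b : 1 ≤ b) (2≤s : 2 ≤ s) →
    Σ[ n ∈ ℕ ] Σ[ G ∈ OrderedGraph n ]
    (fromℕ (length (edges G)) ≤ᴿ
    fromℕ s *ᴿ exp (C *ᴿ log (fromℕ b) (fromℕ-pos 1≤b)
    *ᴿ √ (log (fromℕ s) (fromℕ-pos (<⇒≤ 2≤s))))) ×
    (∀ (χ : Fin n → Fin b) → Σ[ P ∈ OrderedPath G s ] Monochromatic χ P)))
theorem1p2 = fromℕ 130 , fromℕ-pos {130} (s≤s z≤n) , λ where
  -- For b = 1 the exponent vanishes and the bound is s itself, the number of edges of a path.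
  1 s 1≤1 2≤s → suc s , fromEdges (pathEdges s)
    , (λ q q<e → x≤x*exp-nonneg (exponent 1≤1 (<⇒≤ 2≤s)) (<⇒≤ 2≤s)
         (*ᴿ-nonneg (fromℕ 130 *ᴿ log (fromℕ 1) (fromℕ-pos 1≤1)) (√ (log (fromℕ s) (fromℕ-pos (<⇒≤ 2≤s))))
           (*ᴿ-nonneg (fromℕ 130) (log (fromℕ 1) (fromℕ-pos 1≤1))
             (λ q<0 → ℚ.<-trans q<0 (ℕ→ℚ-mono-< {0} {130} (s≤s z≤n)))
             (log-1-nonneg 1≤1))
           (√-nonneg (log (fromℕ s) (fromℕ-pos (<⇒≤ 2≤s)))))
         q (fromℕ-mono-≤ (length-pathEdges s) q q<e))
    , path-arrows s
  b@(suc (suc _)) s@(suc s′) 1≤b 2≤s →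
    let w′ , 2^w²≤s , s<2^t² = square-exponent 2≤s
        n , G , few , arrows = sparse-arrowing {b} {suc w′} {s′} (s≤s (s≤s z≤n)) (s≤s z≤n)
          (ℕ.s≤s⁻¹ 2≤s) 2^w²≤s s<2^t²
    in n , G
     -- A rational below the number of edges is below s′ · b^(32w), whose factors lie in the lower
     -- cuts of s and of the exponential.
     , (λ q q<e → lower-* (fromℕ s) (exp (exponent 1≤b (<⇒≤ 2≤s))) {ℕ→ℚ s′} {ℕ→ℚ b ^ (32 ℕ.* suc w′)}
          (ℕ→ℚ-mono-< {s′} {s} (ℕ.n<1+n s′)) (b^32w<exp w′ 1≤b (<⇒≤ 2≤s) (s≤s (s≤s z≤n)) 2^w²≤s)
          (0≤ℕ→ℚ s′) (0≤^ (0≤ℕ→ℚ b) (32 ℕ.* suc w′))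
          (subst (q ℚ.<_) (trans (ℕ→ℚ-* s′ (b ℕ.^ (32 ℕ.* suc w′)))
              (cong (ℕ→ℚ s′ ℚ.*_) (ℕ→ℚ-^ b (32 ℕ.* suc w′))))
            (fromℕ-mono-≤ few q q<e)))
     , arrows
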